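{- Let $s_1,s_2$ be positive integers and let $$d_0=\Bigl\lfloor\sqrt{4s_1^2+4s_1+(s_2+\tfrac12)^2}-s_2-\tfrac32\Bigr\rfloor.$$ Then $g(s_1,s_2)=\Bigl\lfloor 2s_1+s_2+\tfrac32-\sqrt{4s_1^2+4s_1+(s_2+\tfrac12)^2}\Bigr\rfloor+1$ if and only if $$0<\tfrac{2}{d_0+1}(s_1^2+s_1)-\tfrac{d_0+2}{2}-s_2\le-\frac{R_{d_0}(s_1)}{P_{d_0}(s_1)}.$$
   Context: Binomial coefficients $\binom{n}{k}$ are $0$ when $k<0$ or $k>n$. $f_{s_1,s_2}(N)=\binom{s_2}{N}\sum_i\binom{s_1}{i}\binom{s_1}{N-i}\binom{N}{i}$ for integers $N\ge0$; this function is unimodal, and $g(s_1,s_2)$ denotes the integer at which it attains its maximum (it is known that $g(s_1,s_2)$ equals the displayed floor expression plus $0$ or $1$; if the maximum is attained at two consecutive integers, either is accepted as $g(s_1,s_2)$). For a nonnegative integer $d$, $P_d(x)=\sum_{i=0}^d\frac{(x_i)^2(x_{d-i})^2}{i!(d-i)!}$ with $x_i=x(x-1)\cdots(x-i+1)$, and $R_d(x)$ is the remainder upon polynomial division of $P_{d+1}(x)$ by $P_d(x)$ (quotient $\frac{2}{d+1}x^2-\frac{2d}{d+1}x+\frac d2$). -}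

module Defs where

open import Data.Nat as ℕ using (ℕ; zero; suc; _!; _≟_)
open import Data.Nat.Combinatorics using (_C_)
open import Data.Integer as ℤ using (ℤ; +_)
import Data.Integer.DivMod as ℤD
open import Data.Rational using (ℚ; 0ℚ; 1ℚ; _<_; _≤_; _÷_; -_; _+_; _-_; _*_; ≢-nonZero) renaming (_≟_ to _≟ℚ_)
import Data.Rational as Rat
open import Data.Product using (_×_)
open import Data.Empty using (⊥)
open import Data.Bool using (Bool; true; false; if_then_else_)
open import Relation.Nullary using (yes; no)

sumTo : ℕ → (ℕ → ℕ) → ℕ
sumTo zero    h = h 0
sumTo (suc n) h = sumTo n h ℕ.+ h (suc n)

sumToℚ : ℕ → (ℕ → ℚ) → ℚ
sumToℚ zero    h = h 0
sumToℚ (suc n) h = sumToℚ n h + h (suc n)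

-- binomial coefficient, 0 when k > n (stdlib's _C_ already does this)
-- f_{s1,s2}(N) = C(s2,N) * Σ_i C(s1,i) C(s1,N-i) C(N,i);
-- terms with i > N vanish because C(N,i) = 0, and N-i is only used for i ≤ N.
f : ℕ → ℕ → ℕ → ℕ
f s₁ s₂ N = (s₂ C N) ℕ.* sumTo N (λ i → (s₁ C i) ℕ.* (s₁ C (N ℕ.∸ i)) ℕ.* (N C i))

IsArgmax : (ℕ → ℕ) → ℕ → Set
IsArgmax h g = ∀ N → h N ℕ.≤ h g

isqrtAux : ℕ → ℕ → ℕ
isqrtAux m zero    = 0
isqrtAux m (suc k) = if suc k ℕ.* suc k ℕ.≤ᵇ m then suc k else isqrtAux m k

isqrt : ℕ → ℕ
isqrt m = isqrtAux m m

isqrtCeil : ℕ → ℕ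
isqrtCeil m with isqrt m ℕ.* isqrt m ≟ m
... | yes _ = isqrt m
... | no  _ = suc (isqrt m)

-- 4 * (4 s1^2 + 4 s1 + (s2 + 1/2)^2)  =  16 s1^2 + 16 s1 + (2 s2 + 1)^2,
-- so √(4s1²+4s1+(s2+½)²) = √M / 2.
M : ℕ → ℕ → ℕ
M s₁ s₂ = 16 ℕ.* s₁ ℕ.* s₁ ℕ.+ 16 ℕ.* s₁ ℕ.+ (2 ℕ.* s₂ ℕ.+ 1) ℕ.* (2 ℕ.* s₂ ℕ.+ 1)

-- floor division by 2 on ℤ (Euclidean division by a positive divisor = floor)
half⌊_⌋ : ℤ → ℤ
half⌊ z ⌋ = z ℤD./ (+ 2)

-- d0 = ⌊ √(4s1²+4s1+(s2+½)²) - s2 - 3/2 ⌋ = ⌊ (√M - 2 s2 - 3)/2 ⌋ = ⌊ (⌊√M⌋ - 2 s2 - 3)/2 ⌋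
d₀ : ℕ → ℕ → ℤ
d₀ s₁ s₂ = half⌊ + isqrt (M s₁ s₂) ℤ.- + (2 ℕ.* s₂ ℕ.+ 3) ⌋

-- ⌊ 2s1 + s2 + 3/2 - √(4s1²+4s1+(s2+½)²) ⌋ = ⌊ (4s1 + 2s2 + 3 - √M)/2 ⌋
--   = ⌊ (4s1 + 2s2 + 3 - ⌈√M⌉)/2 ⌋
floorExpr : ℕ → ℕ → ℤ
floorExpr s₁ s₂ = half⌊ + (4 ℕ.* s₁ ℕ.+ 2 ℕ.* s₂ ℕ.+ 3) ℤ.- + isqrtCeil (M s₁ s₂) ⌋

ℕ→ℚ : ℕ → ℚ
ℕ→ℚ n = (+ n) Rat./ 1

falling : ℚ → ℕ → ℚ
falling x zero    = 1ℚ
falling x (suc i) = falling x i * (x - ℕ→ℚ i)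

-- total division on ℚ: p / q, with the (irrelevant) convention p / 0 = 0
_/ℚ_ : ℚ → ℚ → ℚ
p /ℚ q with q ≟ℚ 0ℚ
... | yes _ = 0ℚ
... | no q≢0 = _÷_ p q {{≢-nonZero q≢0}}

P : ℕ → ℚ → ℚ
P d x = sumToℚ d (λ i →
  (falling x i * falling x i * falling x (d ℕ.∸ i) * falling x (d ℕ.∸ i))
    /ℚ ℕ→ℚ ((i !) ℕ.* ((d ℕ.∸ i) !)))

-- the stated quotient of P_{d+1} by P_d : (2/(d+1)) x² - (2d/(d+1)) x + d/2
Q : ℕ → ℚ → ℚ
Q d x = (ℕ→ℚ 2 /ℚ ℕ→ℚ (suc d)) * x * x
        - (ℕ→ℚ (2 ℕ.* d) /ℚ ℕ→ℚ (suc d)) * x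
        + (ℕ→ℚ d /ℚ ℕ→ℚ 2)

-- R_d(x) : remainder of P_{d+1} divided by P_d, i.e. P_{d+1} - Q_d * P_d
R : ℕ → ℚ → ℚ
R d x = P (suc d) x - Q d x * P d x

-- the condition  0 < 2/(d0+1)(s1²+s1) - (d0+2)/2 - s2 ≤ -R_{d0}(s1)/P_{d0}(s1)
-- (only meaningful for d0 ≥ 0; for d0 < 0 it is taken to be false)
CondAt : ℕ → ℕ → ℕ → Set
CondAt s₁ s₂ d =
  let x = ℕ→ℚ s₁
      c = (ℕ→ℚ 2 /ℚ ℕ→ℚ (suc d)) * (x * x + x) - (ℕ→ℚ (d ℕ.+ 2) /ℚ ℕ→ℚ 2) - ℕ→ℚ s₂
  in (0ℚ < c) × (c ≤ - (R d x /ℚ P d x))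

Cond : ℕ → ℕ → Set
Cond s₁ s₂ with d₀ s₁ s₂
... | + d = CondAt s₁ s₂ d
... | ℤ.-[1+ _ ] = ⊥

{-# OPTIONS --safe #-}
module Submission where

-- Let a_k be the number of k-rook placements on an n × n board, n = s₁.  Then
-- P_d(n) = Σ_{i+j=d} a_i a_j, and f(2n − d) is P_d(n) times s₂! / (s₂ − 2n + d)!
-- up to a factor independent of d.  So f(N) ≤ f(N + 1), with N = 2n − d − 1, says
-- P_{d+1} ≤ (s₂ − N) P_d, and since Q_d − (s₂ − N) is the middle term c_d of the
-- condition, this is c_d ≤ − R_d / P_d.
--
-- From (k + 1) a_{k+1} = (n − k)² a_k one gets
--   2 (d + 1) R_d = Σ_{i+j=d} ((i − j)² − d) a_i a_j
--                 = − (2n − d + 1) Σ_{i+j=d−1} (i − j)² a_i a_j,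
-- whence − 1/2 < R_d / P_d ≤ 0 for d ≤ 2n.  As c_d decreases by more than 1/2 at each
-- step and d₀ is the last d with c_d ≥ 0, f increases up to 2n − d₀ − 1 and decreases
-- from 2n − d₀ on; only the comparison between these two points is left open, and the
-- condition decides it.  If c_{d₀} = 0, the floor in the formula for g moves up by one
-- while the maximum is at 2n − d₀.

open import Defs
open import Data.Bool using (true; false; T)
open import Data.Nat as ℕ using (ℕ; zero; suc; _!; _∸_; z≤n; s≤s)
import Data.Nat.Properties as ℕₚ
import Data.Nat.DivMod as ℕD
open import Data.Nat.Combinatorics using (_C_; nCk≡n!/k![n-k]!; nCk≡nC[n∸k]; k>n⇒nCk≡0; k![n∸k]!∣n!)
import Data.Nat.Tactic.RingSolver as ℕ-Solver
open import Data.Integer as ℤ using (ℤ; +_; 0ℤ; 1ℤ)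
import Data.Integer.Properties as ℤₚ
import Data.Integer.DivMod as ℤD
import Data.Integer.Tactic.RingSolver as ℤ-Solver
open import Data.Rational as ℚ using (ℚ; 0ℚ; toℚᵘ; ≢-nonZero)
import Data.Rational.Properties as ℚₚ
import Data.Rational.Solver as ℚS
open import Data.Rational.Unnormalised as ℚᵘ using (mkℚᵘ; *≡*; *≤*; *<*)
import Data.Rational.Unnormalised.Properties as ℚᵘₚ
open import Data.Product using (Σ; ∃; _×_; _,_; proj₁; proj₂)
open import Data.Sum using (inj₁; inj₂)
open import Data.Unit using (tt)
open import Function.Bundles using (_⇔_; mk⇔; Equivalence)
open import Relation.Binary.PropositionalEquality
open import Relation.Nullary using (yes; no; ¬_; contradiction)

-- Binomial coefficients

choose-! : ∀ {n} i j → i ℕ.+ j ≡ n → (n C i) ℕ.* (i ! ℕ.* j !) ≡ n !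
choose-! i j refl = begin
  ((i ℕ.+ j) C i) ℕ.* (i ! ℕ.* j !)
    ≡⟨ cong (λ k → ((i ℕ.+ j) C i) ℕ.* (i ! ℕ.* k !)) (sym (ℕₚ.m+n∸m≡n i j)) ⟩
  ((i ℕ.+ j) C i) ℕ.* D
    ≡⟨ cong (ℕ._* D) (nCk≡n!/k![n-k]! (ℕₚ.m≤m+n i j)) ⟩
  ((i ℕ.+ j) ! ℕ./ D) ℕ.* D
    ≡⟨ ℕD.m/n*n≡m (k![n∸k]!∣n! (ℕₚ.m≤m+n i j)) ⟩
  (i ℕ.+ j) ! ∎
  where
  open ≡-Reasoning
  D = i ! ℕ.* (i ℕ.+ j ∸ i) !
  instance _ = i ℕₚ.!* (i ℕ.+ j ∸ i) !≢0

-- For k ≥ n both sides vanish, the right one by truncated subtraction; for k < n both sides times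
-- k! (n - k - 1)! are n!.
C-suc : ∀ n k → (n C suc k) ℕ.* suc k ≡ (n C k) ℕ.* (n ∸ k)
C-suc n k with ℕₚ.<-≤-connex k n
... | inj₂ n≤k = begin
  (n C suc k) ℕ.* suc k  ≡⟨ cong (ℕ._* suc k) (k>n⇒nCk≡0 (s≤s n≤k)) ⟩
  0                      ≡⟨ sym (ℕₚ.*-zeroʳ (n C k)) ⟩
  (n C k) ℕ.* 0          ≡⟨ cong ((n C k) ℕ.*_) (sym (ℕₚ.m≤n⇒m∸n≡0 n≤k)) ⟩
  (n C k) ℕ.* (n ∸ k)    ∎
  where open ≡-Reasoning
... | inj₁ k<n = ℕₚ.*-cancelʳ-≡ _ _ (k ! ℕ.* j !) {{k ℕₚ.!* j !≢0}} (begin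
  (n C suc k) ℕ.* suc k ℕ.* (k ! ℕ.* j !)    ≡⟨ regroup (n C suc k) (suc k) (k !) (j !) ⟩
  (n C suc k) ℕ.* (suc k ! ℕ.* j !)          ≡⟨ choose-! (suc k) j k+1+j≡n ⟩
  n !                                        ≡⟨ sym (choose-! k (suc j) (trans (ℕₚ.+-suc k j) k+1+j≡n)) ⟩
  (n C k) ℕ.* (k ! ℕ.* (suc j ℕ.* j !))      ≡⟨ regroup′ (n C k) (k !) (suc j) (j !) ⟩
  (n C k) ℕ.* suc j ℕ.* (k ! ℕ.* j !)        ≡⟨ cong (λ m → (n C k) ℕ.* m ℕ.* (k ! ℕ.* j !)) (sym (ℕₚ.+-∸-assoc 1 k<n)) ⟩
  (n C k) ℕ.* (n ∸ k) ℕ.* (k ! ℕ.* j !)      ∎)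
  where
  open ≡-Reasoning
  j = n ∸ suc k
  k+1+j≡n : suc k ℕ.+ j ≡ n
  k+1+j≡n = ℕₚ.m+[n∸m]≡n k<n
  regroup : ∀ c m u v → c ℕ.* m ℕ.* (u ℕ.* v) ≡ c ℕ.* (m ℕ.* u ℕ.* v)
  regroup = ℕ-Solver.solve-∀
  regroup′ : ∀ c u m v → c ℕ.* (u ℕ.* (m ℕ.* v)) ≡ c ℕ.* m ℕ.* (u ℕ.* v)
  regroup′ = ℕ-Solver.solve-∀

-- Falling factorials and rook numbers

fallingℕ : ℕ → ℕ → ℕ
fallingℕ n k = (n C k) ℕ.* k !

fallingℕ-suc : ∀ n k → fallingℕ n (suc k) ≡ fallingℕ n k ℕ.* (n ∸ k)
fallingℕ-suc n k = begin
  (n C suc k) ℕ.* (suc k ℕ.* k !)    ≡⟨ sym (ℕₚ.*-assoc (n C suc k) (suc k) (k !)) ⟩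
  (n C suc k) ℕ.* suc k ℕ.* k !      ≡⟨ cong (ℕ._* k !) (C-suc n k) ⟩
  (n C k) ℕ.* (n ∸ k) ℕ.* k !        ≡⟨ swap (n C k) (n ∸ k) (k !) ⟩
  (n C k) ℕ.* k ! ℕ.* (n ∸ k)        ∎
  where
  open ≡-Reasoning
  swap : ∀ a b c → a ℕ.* b ℕ.* c ≡ a ℕ.* c ℕ.* b
  swap = ℕ-Solver.solve-∀

k>n⇒fallingℕ≡0 : ∀ {n k} → n ℕ.< k → fallingℕ n k ≡ 0
k>n⇒fallingℕ≡0 {k = k} n<k = cong (ℕ._* k !) (k>n⇒nCk≡0 n<k)

-- The number of placements of k non-attacking rooks on an n × n board.
rook : ℕ → ℕ → ℕ
rook n k = (n C k) ℕ.* fallingℕ n k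

-- Counts placements of k + 1 rooks with one of them marked: the marked rook stands on one of the (n
-- - k)² cells whose row and column the other k rooks leave free.
rook-suc : ∀ n k → suc k ℕ.* rook n (suc k) ≡ (n ∸ k) ℕ.* (n ∸ k) ℕ.* rook n k
rook-suc n k = begin
  suc k ℕ.* ((n C suc k) ℕ.* fallingℕ n (suc k))
    ≡⟨ cong (λ v → suc k ℕ.* ((n C suc k) ℕ.* v)) (fallingℕ-suc n k) ⟩
  suc k ℕ.* ((n C suc k) ℕ.* (fallingℕ n k ℕ.* (n ∸ k)))
    ≡⟨ regroup (suc k) (n C suc k) (fallingℕ n k) (n ∸ k) ⟩
  (n C suc k) ℕ.* suc k ℕ.* (fallingℕ n k ℕ.* (n ∸ k))
    ≡⟨ cong (ℕ._* (fallingℕ n k ℕ.* (n ∸ k))) (C-suc n k) ⟩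
  (n C k) ℕ.* (n ∸ k) ℕ.* (fallingℕ n k ℕ.* (n ∸ k))
    ≡⟨ regroup′ (n C k) (fallingℕ n k) (n ∸ k) ⟩
  (n ∸ k) ℕ.* (n ∸ k) ℕ.* ((n C k) ℕ.* fallingℕ n k) ∎
  where
  open ≡-Reasoning
  regroup : ∀ a b c d → a ℕ.* (b ℕ.* (c ℕ.* d)) ≡ b ℕ.* a ℕ.* (c ℕ.* d)
  regroup = ℕ-Solver.solve-∀
  regroup′ : ∀ b c d → b ℕ.* d ℕ.* (c ℕ.* d) ≡ d ℕ.* d ℕ.* (b ℕ.* c)
  regroup′ = ℕ-Solver.solve-∀

k>n⇒rook≡0 : ∀ {n k} → n ℕ.< k → rook n k ≡ 0
k>n⇒rook≡0 {n} {k} n<k = cong (ℕ._* fallingℕ n k) (k>n⇒nCk≡0 n<k)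

rook>0 : ∀ {n k} → k ℕ.≤ n → 0 ℕ.< rook n k
rook>0 {n} {k} k≤n = ℕₚ.*-mono-< C>0 (ℕₚ.*-mono-< C>0 (ℕₚ.n≢0⇒n>0 (ℕ.≢-nonZero⁻¹ (k !) {{k ℕₚ.!≢0}})))
  where
  C>0 : 0 ℕ.< n C k
  C>0 = ℕₚ.n≢0⇒n>0 (λ c≡0 → ℕ.≢-nonZero⁻¹ (n !) {{n ℕₚ.!≢0}}
    (trans (sym (choose-! k (n ∸ k) (ℕₚ.m+[n∸m]≡n k≤n))) (cong (ℕ._* (k ! ℕ.* (n ∸ k) !)) c≡0)))

-- Sums over i + j = d

module _ where
  open import Data.Integer using (_+_; _*_; _-_; -_; _≤_)

  -- Passing both indices keeps truncated subtraction out of the weights. The recursion peels off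
  -- the term with i = 0, and `conv-last` the one with j = 0.
  conv : ℕ → (ℕ → ℕ → ℤ) → ℤ
  conv zero    φ = φ 0 0
  conv (suc d) φ = φ 0 (suc d) + conv d (λ i j → φ (suc i) j)

  conv-cong : ∀ d {φ ψ} → (∀ i j → i ℕ.+ j ≡ d → φ i j ≡ ψ i j) → conv d φ ≡ conv d ψ
  conv-cong zero    eq = eq 0 0 refl
  conv-cong (suc d) eq =
    cong₂ _+_ (eq 0 (suc d) refl) (conv-cong d (λ i j i+j≡d → eq (suc i) j (cong suc i+j≡d)))

  conv-mono-≤ : ∀ d {φ ψ} → (∀ i j → i ℕ.+ j ≡ d → φ i j ≤ ψ i j) → conv d φ ≤ conv d ψ
  conv-mono-≤ zero    le = le 0 0 refl
  conv-mono-≤ (suc d) le =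
    ℤₚ.+-mono-≤ (le 0 (suc d) refl) (conv-mono-≤ d (λ i j i+j≡d → le (suc i) j (cong suc i+j≡d)))

  conv-+ : ∀ d φ ψ → conv d (λ i j → φ i j + ψ i j) ≡ conv d φ + conv d ψ
  conv-+ zero    φ ψ = refl
  conv-+ (suc d) φ ψ = trans
    (cong (λ v → (φ 0 (suc d) + ψ 0 (suc d)) + v) (conv-+ d (λ i j → φ (suc i) j) (λ i j → ψ (suc i) j)))
    (interchange (φ 0 (suc d)) (ψ 0 (suc d)) (conv d (λ i j → φ (suc i) j)) (conv d (λ i j → ψ (suc i) j)))
    where
    interchange : ∀ a b c d → (a + b) + (c + d) ≡ (a + c) + (b + d)
    interchange = ℤ-Solver.solve-∀

  conv-*ˡ : ∀ d k φ → conv d (λ i j → k * φ i j) ≡ k * conv d φ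
  conv-*ˡ zero    k φ = refl
  conv-*ˡ (suc d) k φ = trans
    (cong (λ v → k * φ 0 (suc d) + v) (conv-*ˡ d k (λ i j → φ (suc i) j)))
    (sym (ℤₚ.*-distribˡ-+ k (φ 0 (suc d)) (conv d (λ i j → φ (suc i) j))))

  conv-last : ∀ d φ → conv (suc d) φ ≡ conv d (λ i j → φ i (suc j)) + φ (suc d) 0
  conv-last zero    φ = refl
  conv-last (suc d) φ = trans
    (cong (λ v → φ 0 (suc (suc d)) + v) (conv-last d (λ i j → φ (suc i) j)))
    (sym (ℤₚ.+-assoc (φ 0 (suc (suc d))) (conv d (λ i j → φ (suc i) (suc j))) (φ (suc (suc d)) 0)))

  -- Weighted rook counts on two boards

  rookℤ : ℕ → ℕ → ℤ
  rookℤ n k = + rook n k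

  -- True subtraction can replace the truncated one because the rook number vanishes for k > n.
  rookℤ-suc : ∀ n k → + suc k * rookℤ n (suc k) ≡ (+ n - + k) * (+ n - + k) * rookℤ n k
  rookℤ-suc n k = begin
    + suc k * rookℤ n (suc k)                       ≡⟨ sym (ℤₚ.pos-* (suc k) (rook n (suc k))) ⟩
    + (suc k ℕ.* rook n (suc k))                    ≡⟨ cong +_ (rook-suc n k) ⟩
    + ((n ∸ k) ℕ.* (n ∸ k) ℕ.* rook n k)            ≡⟨ ℤₚ.pos-* ((n ∸ k) ℕ.* (n ∸ k)) (rook n k) ⟩
    + ((n ∸ k) ℕ.* (n ∸ k)) * rookℤ n k             ≡⟨ cong (_* rookℤ n k) (ℤₚ.pos-* (n ∸ k) (n ∸ k)) ⟩
    + (n ∸ k) * + (n ∸ k) * rookℤ n k               ≡⟨ monus ⟩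
    (+ n - + k) * (+ n - + k) * rookℤ n k           ∎
    where
    open ≡-Reasoning
    monus : + (n ∸ k) * + (n ∸ k) * rookℤ n k ≡ (+ n - + k) * (+ n - + k) * rookℤ n k
    monus with ℕₚ.≤-<-connex k n
    ... | inj₁ k≤n = cong (λ m → m * m * rookℤ n k)
                       (trans (sym (ℤₚ.⊖-≥ k≤n)) (sym (ℤₚ.m-n≡m⊖n n k)))
    ... | inj₂ n<k rewrite k>n⇒rook≡0 n<k =
      trans (ℤₚ.*-zeroʳ (+ (n ∸ k) * + (n ∸ k))) (sym (ℤₚ.*-zeroʳ ((+ n - + k) * (+ n - + k))))

  -- The φ-weighted count of placements of d rooks on two n × n boards,
  -- i on the first and j on the second.
  W : ℕ → ℕ → (ℕ → ℕ → ℤ) → ℤ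
  W n d φ = conv d (λ i j → φ i j * (rookℤ n i * rookℤ n j))

  W-cong : ∀ n d {φ ψ} → (∀ i j → i ℕ.+ j ≡ d → φ i j ≡ ψ i j) → W n d φ ≡ W n d ψ
  W-cong n d eq = conv-cong d (λ i j i+j≡d → cong (_* (rookℤ n i * rookℤ n j)) (eq i j i+j≡d))

  W-mono-≤ : ∀ n d {φ ψ} → (∀ i j → i ℕ.+ j ≡ d → φ i j ≤ ψ i j) → W n d φ ≤ W n d ψ
  W-mono-≤ n d {φ} {ψ} le = conv-mono-≤ d λ i j i+j≡d →
    subst (λ w → φ i j * w ≤ ψ i j * w) (ℤₚ.pos-* (rook n i) (rook n j))
      (ℤₚ.*-monoʳ-≤-nonNeg (+ (rook n i ℕ.* rook n j)) (le i j i+j≡d))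

  W-+ : ∀ n d φ ψ → W n d (λ i j → φ i j + ψ i j) ≡ W n d φ + W n d ψ
  W-+ n d φ ψ = trans
    (conv-cong d (λ i j _ → ℤₚ.*-distribʳ-+ (rookℤ n i * rookℤ n j) (φ i j) (ψ i j)))
    (conv-+ d (λ i j → φ i j * (rookℤ n i * rookℤ n j)) (λ i j → ψ i j * (rookℤ n i * rookℤ n j)))

  W-*ˡ : ∀ n d k φ → W n d (λ i j → k * φ i j) ≡ k * W n d φ
  W-*ˡ n d k φ = trans
    (conv-cong d (λ i j _ → ℤₚ.*-assoc k (φ i j) (rookℤ n i * rookℤ n j)))
    (conv-*ˡ d k (λ i j → φ i j * (rookℤ n i * rookℤ n j)))

  -- Removing one rook from the first (second) board: a placement of i rooks
  -- extends in (n - i)² ways.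
  W-sucˡ : ∀ n d (φ : ℕ → ℕ → ℤ) → W n (suc d) (λ i j → + i * φ i j) ≡ W n d (λ i j → (+ n - + i) * (+ n - + i) * φ (suc i) j)
  W-sucˡ n d φ = trans (ℤₚ.+-identityˡ _) (conv-cong d step)
    where
    regroup : ∀ s φ a b → s * φ * (a * b) ≡ φ * (s * a * b)
    regroup = ℤ-Solver.solve-∀
    regroup′ : ∀ m φ a b → φ * (m * a * b) ≡ m * φ * (a * b)
    regroup′ = ℤ-Solver.solve-∀
    step : ∀ i j → i ℕ.+ j ≡ d →
      + suc i * φ (suc i) j * (rookℤ n (suc i) * rookℤ n j)
        ≡ (+ n - + i) * (+ n - + i) * φ (suc i) j * (rookℤ n i * rookℤ n j)
    step i j _ = trans (regroup (+ suc i) (φ (suc i) j) (rookℤ n (suc i)) (rookℤ n j))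
      (trans (cong (λ v → φ (suc i) j * (v * rookℤ n j)) (rookℤ-suc n i))
        (regroup′ ((+ n - + i) * (+ n - + i)) (φ (suc i) j) (rookℤ n i) (rookℤ n j)))

  W-sucʳ : ∀ n d (φ : ℕ → ℕ → ℤ) → W n (suc d) (λ i j → + j * φ i j) ≡ W n d (λ i j → (+ n - + j) * (+ n - + j) * φ i (suc j))
  W-sucʳ n d φ = trans
    (conv-last d (λ i j → + j * φ i j * (rookℤ n i * rookℤ n j)))
    (trans (ℤₚ.+-identityʳ _) (conv-cong d step))
    where
    regroup : ∀ s φ a b → s * φ * (a * b) ≡ φ * (s * b * a)
    regroup = ℤ-Solver.solve-∀
    regroup′ : ∀ m φ a b → φ * (m * b * a) ≡ m * φ * (a * b)
    regroup′ = ℤ-Solver.solve-∀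
    step : ∀ i j → i ℕ.+ j ≡ d →
      + suc j * φ i (suc j) * (rookℤ n i * rookℤ n (suc j))
        ≡ (+ n - + j) * (+ n - + j) * φ i (suc j) * (rookℤ n i * rookℤ n j)
    step i j _ = trans (regroup (+ suc j) (φ i (suc j)) (rookℤ n i) (rookℤ n (suc j)))
      (trans (cong (λ v → φ i (suc j) * (v * rookℤ n i)) (rookℤ-suc n j))
        (regroup′ ((+ n - + j) * (+ n - + j)) (φ i (suc j)) (rookℤ n i) (rookℤ n j)))

  -- This is P_d(n), by `pℕ≡p` and `P-ι`.
  p : ℕ → ℕ → ℤ
  p n d = W n d (λ _ _ → 1ℤ)

  -- As d + 1 = i + j, the factor marks one of the d + 1 rooks, on the first or on the second board,
  -- and the marked rook is taken off.
  p-suc : ∀ n d → + suc d * p n (suc d)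
    ≡ W n d (λ i j → (+ n - + i) * (+ n - + i) + (+ n - + j) * (+ n - + j))
  p-suc n d = begin
    + suc d * p n (suc d)
      ≡⟨ sym (W-*ˡ n (suc d) (+ suc d) (λ _ _ → 1ℤ)) ⟩
    W n (suc d) (λ _ _ → + suc d * 1ℤ)
      ≡⟨ W-cong n (suc d) (λ i j i+j≡d → trans (cong (λ m → + m * 1ℤ) (sym i+j≡d)) (ℤₚ.*-distribʳ-+ 1ℤ (+ i) (+ j))) ⟩
    W n (suc d) (λ i j → + i * 1ℤ + + j * 1ℤ)
      ≡⟨ W-+ n (suc d) (λ i j → + i * 1ℤ) (λ i j → + j * 1ℤ) ⟩
    W n (suc d) (λ i j → + i * 1ℤ) + W n (suc d) (λ i j → + j * 1ℤ)
      ≡⟨ cong₂ _+_ (W-sucˡ n d (λ _ _ → 1ℤ)) (W-sucʳ n d (λ _ _ → 1ℤ)) ⟩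
    W n d (λ i j → (+ n - + i) * (+ n - + i) * 1ℤ) + W n d (λ i j → (+ n - + j) * (+ n - + j) * 1ℤ)
      ≡⟨ sym (W-+ n d (λ i j → (+ n - + i) * (+ n - + i) * 1ℤ) (λ i j → (+ n - + j) * (+ n - + j) * 1ℤ)) ⟩
    W n d (λ i j → (+ n - + i) * (+ n - + i) * 1ℤ + (+ n - + j) * (+ n - + j) * 1ℤ)
      ≡⟨ W-cong n d (λ i j _ → cong₂ _+_ (ℤₚ.*-identityʳ ((+ n - + i) * (+ n - + i))) (ℤₚ.*-identityʳ ((+ n - + j) * (+ n - + j)))) ⟩
    W n d (λ i j → (+ n - + i) * (+ n - + i) + (+ n - + j) * (+ n - + j)) ∎
    where open ≡-Reasoning

  -- The sum is 2 (d + 2) R_{d+1}(n). Its weight is i (i - j - 1) + j (j - i - 1), so one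
  -- rook can be taken off either board, leaving a multiple of a square.
  variance-excess : ∀ n d → W n (suc d) (λ i j → (+ i - + j) * (+ i - + j) - + suc d)
    ≡ (+ d - + 2 * + n) * W n d (λ i j → (+ i - + j) * (+ i - + j))
  variance-excess n d = begin
    W n (suc d) (λ i j → (+ i - + j) * (+ i - + j) - + suc d)
      ≡⟨ W-cong n (suc d) split ⟩
    W n (suc d) (λ i j → + i * (+ i - + j - 1ℤ) + + j * (+ j - + i - 1ℤ))
      ≡⟨ W-+ n (suc d) (λ i j → + i * (+ i - + j - 1ℤ)) (λ i j → + j * (+ j - + i - 1ℤ)) ⟩
    W n (suc d) (λ i j → + i * (+ i - + j - 1ℤ)) + W n (suc d) (λ i j → + j * (+ j - + i - 1ℤ))
      ≡⟨ cong₂ _+_ (W-sucˡ n d (λ i j → + i - + j - 1ℤ)) (W-sucʳ n d (λ i j → + j - + i - 1ℤ)) ⟩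
    W n d (λ i j → (+ n - + i) * (+ n - + i) * (+ suc i - + j - 1ℤ)) + W n d (λ i j → (+ n - + j) * (+ n - + j) * (+ suc j - + i - 1ℤ))
      ≡⟨ sym (W-+ n d (λ i j → (+ n - + i) * (+ n - + i) * (+ suc i - + j - 1ℤ)) (λ i j → (+ n - + j) * (+ n - + j) * (+ suc j - + i - 1ℤ))) ⟩
    W n d (λ i j → (+ n - + i) * (+ n - + i) * (+ suc i - + j - 1ℤ) + (+ n - + j) * (+ n - + j) * (+ suc j - + i - 1ℤ))
      ≡⟨ W-cong n d merge ⟩
    W n d (λ i j → (+ d - + 2 * + n) * ((+ i - + j) * (+ i - + j)))
      ≡⟨ W-*ˡ n d (+ d - + 2 * + n) (λ i j → (+ i - + j) * (+ i - + j)) ⟩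
    (+ d - + 2 * + n) * W n d (λ i j → (+ i - + j) * (+ i - + j)) ∎
    where
    open ≡-Reasoning
    split-identity : ∀ i j → (i - j) * (i - j) - (i + j) ≡ i * (i - j - 1ℤ) + j * (j - i - 1ℤ)
    split-identity = ℤ-Solver.solve-∀
    split : ∀ i j → i ℕ.+ j ≡ suc d → _ ≡ _
    split i j i+j≡d = trans (cong (λ m → (+ i - + j) * (+ i - + j) - + m) (sym i+j≡d)) (split-identity (+ i) (+ j))
    -- The sum is (i - j) ((n - i)² - (n - j)²), and the difference of squares contains the factor j
    -- - i.
    merge-identity : ∀ n i j → (n - i) * (n - i) * (1ℤ + i - j - 1ℤ) + (n - j) * (n - j) * (1ℤ + j - i - 1ℤ)
      ≡ (i + j - + 2 * n) * ((i - j) * (i - j))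
    merge-identity = ℤ-Solver.solve-∀
    merge : ∀ i j → i ℕ.+ j ≡ d → _ ≡ _
    merge i j i+j≡d = trans (merge-identity (+ n) (+ i) (+ j))
      (cong (λ m → (+ m - + 2 * + n) * ((+ i - + j) * (+ i - + j))) i+j≡d)

  -- Bounds for P_{d+1} in terms of P_d

  square-nonNeg : ∀ i → 0ℤ ≤ i * i
  square-nonNeg (+ n)      = subst (0ℤ ≤_) (ℤₚ.pos-* n n) (ℤ.+≤+ z≤n)
  square-nonNeg ℤ.-[1+ n ] = ℤ.+≤+ z≤n

  0≤j-i⇒i≤j : ∀ {i j k} → k ≡ j - i → 0ℤ ≤ k → i ≤ j
  0≤j-i⇒i≤j k≡j-i 0≤k = ℤₚ.0≤i-j⇒j≤i (subst (0ℤ ≤_) k≡j-i 0≤k)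

  W-0≤ : ∀ n d {φ} → (∀ i j → i ℕ.+ j ≡ d → 0ℤ ≤ φ i j) → 0ℤ ≤ W n d φ
  W-0≤ n d {φ} 0≤φ = subst (_≤ W n d φ) (W-*ˡ n d 0ℤ (λ _ _ → 1ℤ)) (W-mono-≤ n d 0≤φ)

  -- This is R_d(n) ≤ 0, up to the factor 2 (d + 1). For d > 0, `variance-excess` gives a
  -- non-positive number times a sum of squares.
  variance≤ : ∀ n d → d ℕ.≤ 2 ℕ.* n → W n d (λ i j → (+ i - + j) * (+ i - + j) - + d) ≤ 0ℤ
  variance≤ n zero    _    = ℤₚ.≤-refl
  variance≤ n (suc d) d<2n = subst (_≤ 0ℤ) (sym (variance-excess n d))
    (subst ((+ d - + 2 * + n) * V ≤_) (ℤₚ.*-zeroˡ V)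
      (ℤₚ.*-monoʳ-≤-nonNeg V {{ℤ.nonNegative V≥0}} d-2n≤0))
    where
    V = W n d (λ i j → (+ i - + j) * (+ i - + j))
    V≥0 : 0ℤ ≤ V
    V≥0 = W-0≤ n d (λ i j _ → square-nonNeg (+ i - + j))
    d-2n≤0 : + d - + 2 * + n ≤ 0ℤ
    d-2n≤0 = ℤₚ.i≤j⇒i-j≤0 (subst (+ d ≤_) (ℤₚ.pos-* 2 n) (ℤ.+≤+ (ℕₚ.<⇒≤ d<2n)))

  -- The factor on the right is 2 (d + 1) Q_d(n), so the bound is P_{d+1} ≤ Q_d P_d at n.
  p-suc-≤ : ∀ n d → d ℕ.≤ 2 ℕ.* n →
    + 2 * (+ suc d * p n (suc d)) ≤ (+ 4 * + n * + n - + 4 * + d * + n + + d * + suc d) * p n d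
  p-suc-≤ n d d≤2n = begin
    + 2 * (+ suc d * p n (suc d))
      ≡⟨ cong (+ 2 *_) (p-suc n d) ⟩
    + 2 * W n d (λ i j → (+ n - + i) * (+ n - + i) + (+ n - + j) * (+ n - + j))
      ≡⟨ sym (W-*ˡ n d (+ 2) (λ i j → (+ n - + i) * (+ n - + i) + (+ n - + j) * (+ n - + j))) ⟩
    W n d (λ i j → + 2 * ((+ n - + i) * (+ n - + i) + (+ n - + j) * (+ n - + j)))
      ≡⟨ W-cong n d split ⟩
    W n d (λ i j → k * 1ℤ + ((+ i - + j) * (+ i - + j) - + d))
      ≡⟨ W-+ n d (λ _ _ → k * 1ℤ) (λ i j → (+ i - + j) * (+ i - + j) - + d) ⟩
    W n d (λ i j → k * 1ℤ) + W n d (λ i j → (+ i - + j) * (+ i - + j) - + d)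
      ≤⟨ ℤₚ.+-mono-≤ (ℤₚ.≤-reflexive (W-*ˡ n d k (λ _ _ → 1ℤ))) (variance≤ n d d≤2n) ⟩
    k * p n d + 0ℤ
      ≡⟨ ℤₚ.+-identityʳ _ ⟩
    k * p n d ∎
    where
    open ℤₚ.≤-Reasoning
    k = + 4 * + n * + n - + 4 * + d * + n + + d * + suc d
    split-identity : ∀ n i j → + 2 * ((n - i) * (n - i) + (n - j) * (n - j))
      ≡ (+ 4 * n * n - + 4 * (i + j) * n + (i + j) * (1ℤ + (i + j))) * 1ℤ + ((i - j) * (i - j) - (i + j))
    split-identity = ℤ-Solver.solve-∀
    split : ∀ i j → i ℕ.+ j ≡ d → + 2 * ((+ n - + i) * (+ n - + i) + (+ n - + j) * (+ n - + j))
      ≡ k * 1ℤ + ((+ i - + j) * (+ i - + j) - + d)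
    split i j refl = split-identity (+ n) (+ i) (+ j)

  -- The factor (2n - d)² is 2 (d + 1) Q_d(n) - d. It is what remains of the weight in `p-suc`,
  -- doubled, when the square (i - j)² is dropped.
  p-suc-≥ : ∀ n d → (+ 2 * + n - + d) * (+ 2 * + n - + d) * p n d ≤ + 2 * (+ suc d * p n (suc d))
  p-suc-≥ n d = begin
    k * p n d
      ≡⟨ sym (W-*ˡ n d k (λ _ _ → 1ℤ)) ⟩
    W n d (λ _ _ → k * 1ℤ)
      ≤⟨ W-mono-≤ n d {λ _ _ → k * 1ℤ} {λ i j → + 2 * ((+ n - + i) * (+ n - + i) + (+ n - + j) * (+ n - + j))} (λ i j i+j≡d → 0≤j-i⇒i≤j (split i j i+j≡d) (square-nonNeg (+ i - + j))) ⟩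
    W n d (λ i j → + 2 * ((+ n - + i) * (+ n - + i) + (+ n - + j) * (+ n - + j)))
      ≡⟨ W-*ˡ n d (+ 2) (λ i j → (+ n - + i) * (+ n - + i) + (+ n - + j) * (+ n - + j)) ⟩
    + 2 * W n d (λ i j → (+ n - + i) * (+ n - + i) + (+ n - + j) * (+ n - + j))
      ≡⟨ cong (+ 2 *_) (sym (p-suc n d)) ⟩
    + 2 * (+ suc d * p n (suc d)) ∎
    where
    open ℤₚ.≤-Reasoning
    k = (+ 2 * + n - + d) * (+ 2 * + n - + d)
    split-identity : ∀ n i j → (i - j) * (i - j)
      ≡ + 2 * ((n - i) * (n - i) + (n - j) * (n - j)) - (+ 2 * n - (i + j)) * (+ 2 * n - (i + j)) * 1ℤ
    split-identity = ℤ-Solver.solve-∀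
    split : ∀ i j → i ℕ.+ j ≡ d → (+ i - + j) * (+ i - + j)
      ≡ + 2 * ((+ n - + i) * (+ n - + i) + (+ n - + j) * (+ n - + j)) - k * 1ℤ
    split i j refl = split-identity (+ n) (+ i) (+ j)

-- Sums over initial segments

sumTo-cong : ∀ n {h k : ℕ → ℕ} → (∀ i → i ℕ.≤ n → h i ≡ k i) → sumTo n h ≡ sumTo n k
sumTo-cong zero    eq = eq 0 z≤n
sumTo-cong (suc n) eq =
  cong₂ ℕ._+_ (sumTo-cong n (λ i i≤n → eq i (ℕₚ.m≤n⇒m≤1+n i≤n))) (eq (suc n) ℕₚ.≤-refl)

sumTo-0 : ∀ n {h : ℕ → ℕ} → (∀ i → i ℕ.≤ n → h i ≡ 0) → sumTo n h ≡ 0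
sumTo-0 zero    eq = eq 0 z≤n
sumTo-0 (suc n) eq =
  cong₂ ℕ._+_ (sumTo-0 n (λ i i≤n → eq i (ℕₚ.m≤n⇒m≤1+n i≤n))) (eq (suc n) ℕₚ.≤-refl)

sumTo-*ˡ : ∀ n c (h : ℕ → ℕ) → sumTo n (λ i → c ℕ.* h i) ≡ c ℕ.* sumTo n h
sumTo-*ˡ zero    c h = refl
sumTo-*ˡ (suc n) c h = trans
  (cong (ℕ._+ c ℕ.* h (suc n)) (sumTo-*ˡ n c h))
  (sym (ℕₚ.*-distribˡ-+ c (sumTo n h) (h (suc n))))

sumTo-first : ∀ n (h : ℕ → ℕ) → sumTo (suc n) h ≡ h 0 ℕ.+ sumTo n (λ i → h (suc i))
sumTo-first zero    h = refl
sumTo-first (suc n) h = trans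
  (cong (ℕ._+ h (suc (suc n))) (sumTo-first n h))
  (ℕₚ.+-assoc (h 0) (sumTo n (λ i → h (suc i))) (h (suc (suc n))))

sumTo-reverse : ∀ n (h : ℕ → ℕ) → sumTo n (λ i → h (n ∸ i)) ≡ sumTo n h
sumTo-reverse zero    h = refl
sumTo-reverse (suc n) h = trans
  (sumTo-first n (λ i → h (suc n ∸ i)))
  (trans (cong (h (suc n) ℕ.+_) (sumTo-reverse n h)) (ℕₚ.+-comm (h (suc n)) (sumTo n h)))

term≤sumTo : ∀ n (h : ℕ → ℕ) {i} → i ℕ.≤ n → h i ℕ.≤ sumTo n h
term≤sumTo zero    h z≤n = ℕₚ.≤-refl
term≤sumTo (suc n) h i≤1+n with ℕₚ.m≤n⇒m<n∨m≡n i≤1+n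
... | inj₁ (s≤s i≤n) = ℕₚ.≤-trans (term≤sumTo n h i≤n) (ℕₚ.m≤m+n (sumTo n h) (h (suc n)))
... | inj₂ refl      = ℕₚ.m≤n+m (h (suc n)) (sumTo n h)

sumTo-truncate : ∀ m e (h : ℕ → ℕ) → (∀ i → i ℕ.≤ m ℕ.+ e → m ℕ.< i → h i ≡ 0) → sumTo (m ℕ.+ e) h ≡ sumTo m h
sumTo-truncate m zero    h h≡0 = cong (λ k → sumTo k h) (ℕₚ.+-identityʳ m)
sumTo-truncate m (suc e) h h≡0 rewrite ℕₚ.+-suc m e = trans
  (cong₂ ℕ._+_ (sumTo-truncate m e h (λ i i≤m+e → h≡0 i (ℕₚ.m≤n⇒m≤1+n i≤m+e)))
               (h≡0 (suc (m ℕ.+ e)) ℕₚ.≤-refl (s≤s (ℕₚ.m≤m+n m e))))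
  (ℕₚ.+-identityʳ (sumTo m h))

-- For sums, as in `term-sum`, where either range may be the longer one.
sumTo-match : ∀ m n {h k : ℕ → ℕ} →
  (∀ i → i ℕ.≤ m → i ℕ.≤ n → h i ≡ k i) →
  (∀ i → i ℕ.≤ m → n ℕ.< i → h i ≡ 0) →
  (∀ i → i ℕ.≤ n → m ℕ.< i → k i ≡ 0) →
  sumTo m h ≡ sumTo n k
sumTo-match m n {h} {k} h≡k h≡0 k≡0 with ℕₚ.≤-total m n
... | inj₁ m≤n with ℕₚ.m≤n⇒∃[o]m+o≡n m≤n
...   | e , refl = trans
  (sumTo-cong m (λ i i≤m → h≡k i i≤m (ℕₚ.≤-trans i≤m m≤n)))
  (sym (sumTo-truncate m e k k≡0))
sumTo-match m n {h} {k} h≡k h≡0 k≡0 | inj₂ n≤m with ℕₚ.m≤n⇒∃[o]m+o≡n n≤m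
...   | e , refl = trans
  (sumTo-truncate n e h h≡0)
  (sumTo-cong n (λ i i≤n → h≡k i (ℕₚ.≤-trans i≤n n≤m) i≤n))

sumTo-conv : ∀ d (h : ℕ → ℕ → ℕ) → + sumTo d (λ i → h i (d ∸ i)) ≡ conv d (λ i j → + h i j)
sumTo-conv zero    h = refl
sumTo-conv (suc d) h = begin
  + (sumTo d (λ i → h i (suc d ∸ i)) ℕ.+ h (suc d) (d ∸ d))
    ≡⟨ cong₂ (λ u v → + (u ℕ.+ h (suc d) v)) (sumTo-cong d (λ i i≤d → cong (h i) (ℕₚ.+-∸-assoc 1 i≤d))) (ℕₚ.n∸n≡0 d) ⟩
  + (sumTo d (λ i → h i (suc (d ∸ i))) ℕ.+ h (suc d) 0)
    ≡⟨ cong (λ v → v ℤ.+ + h (suc d) 0) (sumTo-conv d (λ i j → h i (suc j))) ⟩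
  conv d (λ i j → + h i (suc j)) ℤ.+ + h (suc d) 0
    ≡⟨ sym (conv-last d (λ i j → + h i j)) ⟩
  conv (suc d) (λ i j → + h i j) ∎
  where open ≡-Reasoning

pℕ : ℕ → ℕ → ℕ
pℕ n d = sumTo d (λ i → rook n i ℕ.* rook n (d ∸ i))

pℕ≡p : ∀ n d → + pℕ n d ≡ p n d
pℕ≡p n d = trans (sumTo-conv d (λ i j → rook n i ℕ.* rook n j))
  (conv-cong d (λ i j _ → trans (ℤₚ.pos-* (rook n i) (rook n j)) (sym (ℤₚ.*-identityˡ (rookℤ n i ℤ.* rookℤ n j)))))

-- One positive summand suffices: i = d if d ≤ n, and otherwise i = n, which leaves d - n ≤ n rooks
-- for the second board. Division by P_d(n) rests on this.
pℕ>0 : ∀ n d → d ℕ.≤ n ℕ.+ n → 0 ℕ.< pℕ n d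
pℕ>0 n d d≤2n with ℕₚ.≤-total d n
... | inj₁ d≤n = ℕₚ.<-≤-trans
  (ℕₚ.*-mono-< (rook>0 d≤n) (rook>0 (ℕₚ.≤-trans (ℕₚ.≤-reflexive (ℕₚ.n∸n≡0 d)) z≤n)))
  (term≤sumTo d (λ i → rook n i ℕ.* rook n (d ∸ i)) ℕₚ.≤-refl)
... | inj₂ n≤d = ℕₚ.<-≤-trans
  (ℕₚ.*-mono-< (rook>0 (ℕₚ.≤-refl {n})) (rook>0 (ℕₚ.m≤n+o⇒m∸n≤o d n d≤2n)))
  (term≤sumTo d (λ i → rook n i ℕ.* rook n (d ∸ i)) n≤d)

-- f in terms of P_d

m+n<o⇒n<o∸m : ∀ m n {o} → m ℕ.+ n ℕ.< o → n ℕ.< o ∸ m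
m+n<o⇒n<o∸m m n {o} lt = ℕₚ.m+n≤o⇒m≤o∸n (suc n) (subst (ℕ._≤ o) (cong suc (ℕₚ.+-comm m n)) lt)

term : ℕ → ℕ → ℕ → ℕ
term n N i = (n C i) ℕ.* (n C (N ∸ i)) ℕ.* (N C i)

-- Both sides equal n!² C(n, j) C(n, l) C(i + m, i).
term-complement : ∀ {n} i j m l → i ℕ.+ j ≡ n → m ℕ.+ l ≡ n →
  (i ℕ.+ m) ! ℕ.* (rook n j ℕ.* rook n l) ≡ n ! ℕ.* n ! ℕ.* term n (i ℕ.+ m) i
term-complement {n} i j m l i+j≡n m+l≡n = begin
  (i ℕ.+ m) ! ℕ.* (rook n j ℕ.* rook n l)
    ≡⟨ cong (ℕ._* (rook n j ℕ.* rook n l)) (sym (choose-! i m refl)) ⟩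
  B ℕ.* (i ! ℕ.* m !) ℕ.* (rook n j ℕ.* rook n l)
    ≡⟨ regroup B (i !) (m !) (n C j) (j !) (n C l) (l !) ⟩
  (n C j) ℕ.* (j ! ℕ.* i !) ℕ.* ((n C l) ℕ.* (l ! ℕ.* m !)) ℕ.* ((n C j) ℕ.* (n C l) ℕ.* B)
    ≡⟨ cong₂ (λ u v → u ℕ.* v ℕ.* ((n C j) ℕ.* (n C l) ℕ.* B))
         (choose-! j i (trans (ℕₚ.+-comm j i) i+j≡n)) (choose-! l m (trans (ℕₚ.+-comm l m) m+l≡n)) ⟩
  n ! ℕ.* n ! ℕ.* ((n C j) ℕ.* (n C l) ℕ.* B)
    ≡⟨ cong₂ (λ u v → n ! ℕ.* n ! ℕ.* (u ℕ.* v ℕ.* B)) (complement i j i+j≡n) (complement m l m+l≡n) ⟩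
  n ! ℕ.* n ! ℕ.* ((n C i) ℕ.* (n C m) ℕ.* B)
    ≡⟨ cong (λ v → n ! ℕ.* n ! ℕ.* ((n C i) ℕ.* (n C v) ℕ.* B)) (sym (ℕₚ.m+n∸m≡n i m)) ⟩
  n ! ℕ.* n ! ℕ.* term n (i ℕ.+ m) i ∎
  where
  open ≡-Reasoning
  B = (i ℕ.+ m) C i
  regroup : ∀ b i m u j v l → b ℕ.* (i ℕ.* m) ℕ.* (u ℕ.* (u ℕ.* j) ℕ.* (v ℕ.* (v ℕ.* l)))
    ≡ u ℕ.* (j ℕ.* i) ℕ.* (v ℕ.* (l ℕ.* m)) ℕ.* (u ℕ.* v ℕ.* b)
  regroup = ℕ-Solver.solve-∀
  complement : ∀ i j → i ℕ.+ j ≡ n → n C j ≡ n C i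
  complement i j refl = trans (nCk≡nC[n∸k] (ℕₚ.m≤n+m j i)) (cong ((i ℕ.+ j) C_) (ℕₚ.m+n∸n≡m i j))

-- The substitution i = n - j matches the summands by `term-complement`. Wherever that does not
-- apply, a rook number or a binomial coefficient is zero.
term-sum : ∀ n N d → N ℕ.+ d ≡ n ℕ.+ n → n ! ℕ.* n ! ℕ.* sumTo N (term n N) ≡ N ! ℕ.* pℕ n d
term-sum n N d N+d≡2n = sym (begin
  N ! ℕ.* pℕ n d
    ≡⟨ sym (sumTo-*ˡ d (N !) g) ⟩
  sumTo d (λ j → N ! ℕ.* g j)
    ≡⟨ sumTo-match d n match-both match-d match-n ⟩
  sumTo n (λ j → n ! ℕ.* n ! ℕ.* term n N (n ∸ j))
    ≡⟨ sumTo-reverse n (λ i → n ! ℕ.* n ! ℕ.* term n N i) ⟩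
  sumTo n (λ i → n ! ℕ.* n ! ℕ.* term n N i)
    ≡⟨ sumTo-*ˡ n (n ! ℕ.* n !) (term n N) ⟩
  n ! ℕ.* n ! ℕ.* sumTo n (term n N)
    ≡⟨ cong (n ! ℕ.* n ! ℕ.*_) (sumTo-match n N (λ _ _ _ → refl)
         (λ i _ N<i → N<i⇒0 i N<i) (λ i _ n<i → cong (λ v → v ℕ.* (n C (N ∸ i)) ℕ.* (N C i)) (k>n⇒nCk≡0 n<i))) ⟩
  n ! ℕ.* n ! ℕ.* sumTo N (term n N) ∎)
  where
  open ≡-Reasoning
  g : ℕ → ℕ
  g j = rook n j ℕ.* rook n (d ∸ j)
  N<i⇒0 : ∀ i → N ℕ.< i → term n N i ≡ 0
  N<i⇒0 i N<i = trans (cong ((n C i) ℕ.* (n C (N ∸ i)) ℕ.*_) (k>n⇒nCk≡0 N<i)) (ℕₚ.*-zeroʳ ((n C i) ℕ.* (n C (N ∸ i))))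
  scaled-0 : ∀ {c t} → t ≡ 0 → c ℕ.* t ≡ 0
  scaled-0 {c} t≡0 = trans (cong (c ℕ.*_) t≡0) (ℕₚ.*-zeroʳ c)

  -- With i = n - j this says N - i = n - l, in a form that stays meaningful for l > n.
  exponents : ∀ j l → j ℕ.≤ n → j ℕ.+ l ≡ d → N ℕ.+ l ≡ n ∸ j ℕ.+ n
  exponents j l j≤n j+l≡d = ℕₚ.+-cancelʳ-≡ j (N ℕ.+ l) (n ∸ j ℕ.+ n) (begin
    N ℕ.+ l ℕ.+ j        ≡⟨ swap N l j ⟩
    N ℕ.+ (j ℕ.+ l)      ≡⟨ cong (N ℕ.+_) j+l≡d ⟩
    N ℕ.+ d              ≡⟨ N+d≡2n ⟩
    n ℕ.+ n              ≡⟨ cong (ℕ._+ n) (sym (ℕₚ.m∸n+n≡m j≤n)) ⟩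
    n ∸ j ℕ.+ j ℕ.+ n    ≡⟨ swap′ (n ∸ j) j n ⟩
    n ∸ j ℕ.+ n ℕ.+ j    ∎)
    where
    swap : ∀ a b c → a ℕ.+ b ℕ.+ c ≡ a ℕ.+ (c ℕ.+ b)
    swap = ℕ-Solver.solve-∀
    swap′ : ∀ a b c → a ℕ.+ b ℕ.+ c ≡ a ℕ.+ c ℕ.+ b
    swap′ = ℕ-Solver.solve-∀

  match-both : ∀ j → j ℕ.≤ d → j ℕ.≤ n → N ! ℕ.* g j ≡ n ! ℕ.* n ! ℕ.* term n N (n ∸ j)
  match-both j j≤d j≤n with ℕₚ.≤-<-connex (d ∸ j) n
  ... | inj₁ l≤n = subst (λ v → v ! ℕ.* g j ≡ n ! ℕ.* n ! ℕ.* term n v (n ∸ j)) i+m≡N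
    (term-complement (n ∸ j) j (n ∸ (d ∸ j)) (d ∸ j) (ℕₚ.m∸n+n≡m j≤n) (ℕₚ.m∸n+n≡m l≤n))
    where
    i+m≡N : n ∸ j ℕ.+ (n ∸ (d ∸ j)) ≡ N
    i+m≡N = ℕₚ.+-cancelʳ-≡ (d ∸ j) _ N (begin
      n ∸ j ℕ.+ (n ∸ (d ∸ j)) ℕ.+ (d ∸ j)      ≡⟨ ℕₚ.+-assoc (n ∸ j) (n ∸ (d ∸ j)) (d ∸ j) ⟩
      n ∸ j ℕ.+ (n ∸ (d ∸ j) ℕ.+ (d ∸ j))      ≡⟨ cong (n ∸ j ℕ.+_) (ℕₚ.m∸n+n≡m l≤n) ⟩
      n ∸ j ℕ.+ n                              ≡⟨ sym (exponents j (d ∸ j) j≤n (ℕₚ.m+[n∸m]≡n j≤d)) ⟩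
      N ℕ.+ (d ∸ j)                            ∎)
  ... | inj₂ n<l = trans
    (scaled-0 {N !} (scaled-0 {rook n j} (k>n⇒rook≡0 n<l)))
    (sym (scaled-0 {n ! ℕ.* n !} (N<i⇒0 (n ∸ j) (ℕₚ.+-cancelʳ-< n N (n ∸ j)
      (subst (N ℕ.+ n ℕ.<_) (exponents j (d ∸ j) j≤n (ℕₚ.m+[n∸m]≡n j≤d)) (ℕₚ.+-monoʳ-< N n<l))))))

  match-d : ∀ j → j ℕ.≤ d → n ℕ.< j → N ! ℕ.* g j ≡ 0
  match-d j _ n<j = scaled-0 {N !} (cong (ℕ._* rook n (d ∸ j)) (k>n⇒rook≡0 n<j))

  match-n : ∀ j → j ℕ.≤ n → d ℕ.< j → n ! ℕ.* n ! ℕ.* term n N (n ∸ j) ≡ 0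
  match-n j j≤n d<j = scaled-0 {n ! ℕ.* n !} (cong (ℕ._* (N C (n ∸ j)))
    (scaled-0 {n C (n ∸ j)} (k>n⇒nCk≡0 (m+n<o⇒n<o∸m (n ∸ j) n i+n<N))))
    where
    i+n<N : n ∸ j ℕ.+ n ℕ.< N
    i+n<N = ℕₚ.+-cancelʳ-< j (n ∸ j ℕ.+ n) N (subst (ℕ._< N ℕ.+ j)
      (trans N+d≡2n (trans (cong (ℕ._+ n) (sym (ℕₚ.m∸n+n≡m j≤n))) (swap (n ∸ j) j n)))
      (ℕₚ.+-monoʳ-< N d<j))
      where
      swap : ∀ a b c → a ℕ.+ b ℕ.+ c ≡ a ℕ.+ c ℕ.+ b
      swap = ℕ-Solver.solve-∀

-- The N! from `term-sum` joins C(s, N) to form a falling factorial, which gains just the factor s -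
-- N when N grows by one.
f-formula : ∀ n s N d → N ℕ.+ d ≡ n ℕ.+ n → n ! ℕ.* n ! ℕ.* f n s N ≡ fallingℕ s N ℕ.* pℕ n d
f-formula n s N d N+d≡2n = begin
  n ! ℕ.* n ! ℕ.* ((s C N) ℕ.* sumTo N (term n N))      ≡⟨ swap (n ! ℕ.* n !) (s C N) _ ⟩
  (s C N) ℕ.* (n ! ℕ.* n ! ℕ.* sumTo N (term n N))      ≡⟨ cong ((s C N) ℕ.*_) (term-sum n N d N+d≡2n) ⟩
  (s C N) ℕ.* (N ! ℕ.* pℕ n d)                          ≡⟨ sym (ℕₚ.*-assoc (s C N) (N !) (pℕ n d)) ⟩
  (s C N) ℕ.* N ! ℕ.* pℕ n d                            ∎
  where
  open ≡-Reasoning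
  swap : ∀ a b c → a ℕ.* (b ℕ.* c) ≡ b ℕ.* (a ℕ.* c)
  swap = ℕ-Solver.solve-∀

N>2n⇒f≡0 : ∀ n s {N} → n ℕ.+ n ℕ.< N → f n s N ≡ 0
N>2n⇒f≡0 n s {N} 2n<N = trans (cong ((s C N) ℕ.*_) (sumTo-0 N vanish)) (ℕₚ.*-zeroʳ (s C N))
  where
  vanish : ∀ i → i ℕ.≤ N → term n N i ≡ 0
  vanish i _ with ℕₚ.≤-<-connex i n
  ... | inj₂ n<i = cong (λ v → v ℕ.* (n C (N ∸ i)) ℕ.* (N C i)) (k>n⇒nCk≡0 n<i)
  ... | inj₁ i≤n = cong (ℕ._* (N C i)) (trans
    (cong ((n C i) ℕ.*_) (k>n⇒nCk≡0 (m+n<o⇒n<o∸m i n (ℕₚ.≤-<-trans (ℕₚ.+-monoˡ-≤ n i≤n) 2n<N))))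
    (ℕₚ.*-zeroʳ (n C i)))

-- The two values share `fallingℕ s N`, so P_{d+1} is to be compared with (s - N) P_d. The shared
-- factor is zero for N > s, whence implications rather than equivalences below.
f-steps : ∀ n s N d → N ℕ.+ suc d ≡ n ℕ.+ n →
  (n ! ℕ.* n ! ℕ.* f n s N ≡ fallingℕ s N ℕ.* pℕ n (suc d))
  × (n ! ℕ.* n ! ℕ.* f n s (suc N) ≡ fallingℕ s N ℕ.* ((s ∸ N) ℕ.* pℕ n d))
f-steps n s N d eq = f-formula n s N (suc d) eq , trans
  (f-formula n s (suc N) d (trans (sym (ℕₚ.+-suc N d)) eq))
  (trans (cong (ℕ._* pℕ n d) (fallingℕ-suc s N)) (ℕₚ.*-assoc (fallingℕ s N) (s ∸ N) (pℕ n d)))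

f-step-≤ : ∀ n s N d → N ℕ.+ suc d ≡ n ℕ.+ n → pℕ n (suc d) ℕ.≤ (s ∸ N) ℕ.* pℕ n d → f n s N ℕ.≤ f n s (suc N)
f-step-≤ n s N d eq le = ℕₚ.*-cancelˡ-≤ (n ! ℕ.* n !) {{n ℕₚ.!* n !≢0}}
  (subst₂ ℕ._≤_ (sym (proj₁ (f-steps n s N d eq))) (sym (proj₂ (f-steps n s N d eq))) (ℕₚ.*-monoʳ-≤ (fallingℕ s N) le))

f-step-≥ : ∀ n s N d → N ℕ.+ suc d ≡ n ℕ.+ n → (s ∸ N) ℕ.* pℕ n d ℕ.≤ pℕ n (suc d) → f n s (suc N) ℕ.≤ f n s N
f-step-≥ n s N d eq le = ℕₚ.*-cancelˡ-≤ (n ! ℕ.* n !) {{n ℕₚ.!* n !≢0}}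
  (subst₂ ℕ._≤_ (sym (proj₂ (f-steps n s N d eq))) (sym (proj₁ (f-steps n s N d eq))) (ℕₚ.*-monoʳ-≤ (fallingℕ s N) le))

-- The position of the maximum

-- The part of the radicand in d₀ that depends on n alone; it is (2n + 1)² - 1.
B : ℕ → ℕ
B n = 4 ℕ.* n ℕ.* n ℕ.+ 4 ℕ.* n

-- (e + s + 1/2)² - (s + 1/2)², so that t s e ≤ B n iff e ≤ √(4n² + 4n + (s + 1/2)²) - s - 1/2,
-- and the middle term c of the condition is (B n - t s (d + 1)) / (2 (d + 1)).
t : ℕ → ℕ → ℕ
t s e = e ℕ.* e ℕ.+ e ℕ.* (2 ℕ.* s ℕ.+ 1)

t-mono-≤ : ∀ s {e e′} → e ℕ.≤ e′ → t s e ℕ.≤ t s e′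
t-mono-≤ s e≤e′ = ℕₚ.+-mono-≤ (ℕₚ.*-mono-≤ e≤e′ e≤e′) (ℕₚ.*-monoˡ-≤ (2 ℕ.* s ℕ.+ 1) e≤e′)

module _ where
  open import Data.Integer using (_+_; _*_; _-_; -_; _≤_)

  B-cast : ∀ n → + B n ≡ + 4 * + n * + n + + 4 * + n
  B-cast n = cong₂ _+_ (trans (ℤₚ.pos-* (4 ℕ.* n) n) (cong (_* + n) (ℤₚ.pos-* 4 n))) (ℤₚ.pos-* 4 n)

  t-cast : ∀ s e → + t s e ≡ + e * + e + + e * (+ 2 * + s + 1ℤ)
  t-cast s e = cong₂ _+_ (ℤₚ.pos-* e e)
    (trans (ℤₚ.pos-* e (2 ℕ.* s ℕ.+ 1)) (cong (λ v → + e * (v + 1ℤ)) (ℤₚ.pos-* 2 s)))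

  i-j≤i∸j : ∀ i j → + i - + j ≤ + (i ∸ j)
  i-j≤i∸j i j with ℕₚ.≤-total j i
  ... | inj₁ j≤i = ℤₚ.≤-reflexive (trans (ℤₚ.m-n≡m⊖n i j) (ℤₚ.⊖-≥ j≤i))
  ... | inj₂ i≤j = ℤₚ.≤-trans (ℤₚ.i≤j⇒i-j≤0 (ℤ.+≤+ i≤j)) (ℤ.+≤+ z≤n)

  ≤-monus : ∀ {a b} i j → + a ≤ (+ i - + j) * + b → a ℕ.≤ (i ∸ j) ℕ.* b
  ≤-monus {a} {b} i j le = ℤₚ.drop‿+≤+ (ℤₚ.≤-trans le
    (ℤₚ.≤-trans (ℤₚ.*-monoʳ-≤-nonNeg (+ b) (i-j≤i∸j i j)) (ℤₚ.≤-reflexive (sym (ℤₚ.pos-* (i ∸ j) b)))))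

  monus-≤ : ∀ {a b} i j → (+ i - + j) * + b ≤ + a → (i ∸ j) ℕ.* b ℕ.≤ a
  monus-≤ {a} {b} i j le with ℕₚ.≤-total j i
  ... | inj₁ j≤i = ℤₚ.drop‿+≤+ (ℤₚ.≤-trans (ℤₚ.≤-reflexive (trans (ℤₚ.pos-* (i ∸ j) b)
                     (cong (_* + b) (trans (sym (ℤₚ.⊖-≥ j≤i)) (sym (ℤₚ.m-n≡m⊖n i j)))))) le)
  ... | inj₂ i≤j = subst (λ v → v ℕ.* b ℕ.≤ a) (sym (ℕₚ.m≤n⇒m∸n≡0 i≤j)) z≤n

  +-cast-∸ : ∀ N d {m} → N ℕ.+ d ≡ m → + N ≡ + m - + d
  +-cast-∸ N d refl = identity (+ N) (+ d)
    where
    identity : ∀ i j → i ≡ i + j - j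
    identity = ℤ-Solver.solve-∀

  -- The hypothesis is c_d ≤ 0, that is Q_d(n) ≤ s - N, and `p-suc-≤` bounds P_{d+1} by Q_d P_d.
  f-increasing : ∀ n s N d → N ℕ.+ suc d ≡ n ℕ.+ n → B n ℕ.≤ t s (suc d) → f n s N ℕ.≤ f n s (suc N)
  f-increasing n s N d N+d+1≡2n B≤t = f-step-≤ n s N d N+d+1≡2n (≤-monus s N
    (ℤₚ.*-cancelˡ-≤-pos (+ pℕ n (suc d)) ((+ s - + N) * + pℕ n d) (+ 2 * + suc d) (begin
      + 2 * + suc d * + pℕ n (suc d)         ≡⟨ cong (+ 2 * + suc d *_) (pℕ≡p n (suc d)) ⟩
      + 2 * + suc d * p n (suc d)            ≡⟨ ℤₚ.*-assoc (+ 2) (+ suc d) (p n (suc d)) ⟩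
      + 2 * (+ suc d * p n (suc d))          ≤⟨ p-suc-≤ n d d≤2n ⟩
      k * p n d                              ≡⟨ cong (k *_) (sym (pℕ≡p n d)) ⟩
      k * + pℕ n d                           ≤⟨ ℤₚ.*-monoʳ-≤-nonNeg (+ pℕ n d) (0≤j-i⇒i≤j {k} {+ 2 * + suc d * (+ s - + N)} excess (ℤₚ.i≤j⇒0≤j-i (ℤ.+≤+ B≤t))) ⟩
      + 2 * + suc d * (+ s - + N) * + pℕ n d   ≡⟨ ℤₚ.*-assoc (+ 2 * + suc d) (+ s - + N) (+ pℕ n d) ⟩
      + 2 * + suc d * ((+ s - + N) * + pℕ n d) ∎)))
    where
    open ℤₚ.≤-Reasoning
    k = + 4 * + n * + n - + 4 * + d * + n + + d * + suc d
    d≤2n : d ℕ.≤ 2 ℕ.* n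
    d≤2n = ℕₚ.≤-trans (ℕₚ.n≤1+n d) (ℕₚ.≤-trans (ℕₚ.m≤n+m (suc d) N)
      (ℕₚ.≤-reflexive (trans N+d+1≡2n (cong (n ℕ.+_) (sym (ℕₚ.+-identityʳ n))))))
    identity : ∀ n s d → ((1ℤ + d) * (1ℤ + d) + (1ℤ + d) * (+ 2 * s + 1ℤ)) - (+ 4 * n * n + + 4 * n)
      ≡ + 2 * (1ℤ + d) * (s - (n + n - (1ℤ + d))) - (+ 4 * n * n - + 4 * d * n + d * (1ℤ + d))
    identity = ℤ-Solver.solve-∀
    excess : + t s (suc d) - + B n ≡ + 2 * + suc d * (+ s - + N) - k
    excess = trans (cong₂ _-_ (t-cast s (suc d)) (B-cast n)) (trans (identity (+ n) (+ s) (+ d))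
      (cong (λ v → + 2 * + suc d * (+ s - v) - k) (sym (+-cast-∸ N (suc d) N+d+1≡2n))))

  -- The hypothesis is c_{d+1} ≥ 0. Going down from d + 2 to d + 1 lowers `t s` by 2d + 4 + 2s,
  -- which pays for the d lost in `p-suc-≥` and leaves d + 4 + 2s.
  f-decreasing : ∀ n s N d → N ℕ.+ suc d ≡ n ℕ.+ n → t s (suc (suc d)) ℕ.≤ B n → f n s (suc N) ℕ.≤ f n s N
  f-decreasing n s N d N+d+1≡2n t≤B = f-step-≥ n s N d N+d+1≡2n (monus-≤ s N
    (ℤₚ.*-cancelˡ-≤-pos ((+ s - + N) * + pℕ n d) (+ pℕ n (suc d)) (+ 2 * + suc d) (begin
      + 2 * + suc d * ((+ s - + N) * + pℕ n d) ≡⟨ sym (ℤₚ.*-assoc (+ 2 * + suc d) (+ s - + N) (+ pℕ n d)) ⟩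
      + 2 * + suc d * (+ s - + N) * + pℕ n d   ≤⟨ ℤₚ.*-monoʳ-≤-nonNeg (+ pℕ n d) (0≤j-i⇒i≤j {+ 2 * + suc d * (+ s - + N)} {k} excess
                                                    (ℤₚ.+-mono-≤ (ℤₚ.i≤j⇒0≤j-i (ℤ.+≤+ t≤B)) (ℤ.+≤+ (z≤n {d ℕ.+ 4 ℕ.+ (s ℕ.+ s)})))) ⟩
      k * + pℕ n d                           ≡⟨ cong (k *_) (pℕ≡p n d) ⟩
      k * p n d                              ≤⟨ p-suc-≥ n d ⟩
      + 2 * (+ suc d * p n (suc d))          ≡⟨ sym (ℤₚ.*-assoc (+ 2) (+ suc d) (p n (suc d))) ⟩
      + 2 * + suc d * p n (suc d)            ≡⟨ cong (+ 2 * + suc d *_) (sym (pℕ≡p n (suc d))) ⟩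
      + 2 * + suc d * + pℕ n (suc d)         ∎)))
    where
    open ℤₚ.≤-Reasoning
    k = (+ 2 * + n - + d) * (+ 2 * + n - + d)
    identity : ∀ n s d → (+ 4 * n * n + + 4 * n) - ((1ℤ + (1ℤ + d)) * (1ℤ + (1ℤ + d)) + (1ℤ + (1ℤ + d)) * (+ 2 * s + 1ℤ))
        + (d + + 4 + (s + s))
      ≡ (+ 2 * n - d) * (+ 2 * n - d) - + 2 * (1ℤ + d) * (s - (n + n - (1ℤ + d)))
    identity = ℤ-Solver.solve-∀
    excess : + B n - + t s (suc (suc d)) + + (d ℕ.+ 4 ℕ.+ (s ℕ.+ s)) ≡ k - + 2 * + suc d * (+ s - + N)
    excess = trans (cong (_+ + (d ℕ.+ 4 ℕ.+ (s ℕ.+ s))) (cong₂ _-_ (B-cast n) (t-cast s (suc (suc d)))))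
      (trans (identity (+ n) (+ s) (+ d))
        (cong (λ v → k - + 2 * + suc d * (+ s - v)) (sym (+-cast-∸ N (suc d) N+d+1≡2n))))

-- Monotonicity of f on both sides of one open step

argmax : ∀ (h : ℕ → ℕ) g → (∀ N → N ℕ.< g → h N ℕ.≤ h (suc N)) → (∀ N → g ℕ.≤ N → h (suc N) ℕ.≤ h N) → IsArgmax h g
argmax h g inc dec N with ℕₚ.≤-total N g
... | inj₁ N≤g with ℕₚ.m≤n⇒∃[o]m+o≡n N≤g
...   | o , refl = climb o N (λ i i<N+o → inc i i<N+o)
  where
  climb : ∀ o N → (∀ i → i ℕ.< N ℕ.+ o → h i ℕ.≤ h (suc i)) → h N ℕ.≤ h (N ℕ.+ o)
  climb zero    N _   = ℕₚ.≤-reflexive (cong h (sym (ℕₚ.+-identityʳ N)))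
  climb (suc o) N inc rewrite ℕₚ.+-suc N o =
    ℕₚ.≤-trans (climb o N (λ i lt → inc i (ℕₚ.m≤n⇒m≤1+n lt))) (inc (N ℕ.+ o) ℕₚ.≤-refl)
argmax h g inc dec N | inj₂ g≤N with ℕₚ.m≤n⇒∃[o]m+o≡n g≤N
...   | o , refl = descend o
  where
  descend : ∀ o → h (g ℕ.+ o) ℕ.≤ h g
  descend zero    = ℕₚ.≤-reflexive (cong h (ℕₚ.+-identityʳ g))
  descend (suc o) rewrite ℕₚ.+-suc g o = ℕₚ.≤-trans (dec (g ℕ.+ o) (ℕₚ.m≤m+n g o)) (descend o)

complement-index : ∀ {N m} → N ℕ.< m → ∃ λ d → N ℕ.+ suc d ≡ m
complement-index {N} N<m with ℕₚ.m≤n⇒∃[o]m+o≡n N<m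
... | d , eq = d , trans (ℕₚ.+-suc N d) eq

-- For N = 2n - d - 1, N < G means d ≥ e and N > G means d + 2 ≤ e, so monotonicity of `t` serves
-- this lemma and the next. The step from G to G + 1, with d = e - 1, is covered by neither.
f-increasing-below : ∀ n s e G → G ℕ.+ e ≡ n ℕ.+ n → B n ℕ.< t s (suc e) →
  ∀ N → N ℕ.< G → f n s N ℕ.≤ f n s (suc N)
f-increasing-below n s e G G+e≡2n B<t N N<G
  with complement-index (ℕₚ.<-≤-trans N<G (ℕₚ.≤-trans (ℕₚ.m≤m+n G e) (ℕₚ.≤-reflexive G+e≡2n)))
... | d , eq = f-increasing n s N d eq (ℕₚ.≤-trans (ℕₚ.<⇒≤ B<t) (t-mono-≤ s (ℕₚ.+-cancelˡ-≤ N (suc e) (suc d) (begin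
  N ℕ.+ suc e    ≡⟨ ℕₚ.+-suc N e ⟩
  suc N ℕ.+ e    ≤⟨ ℕₚ.+-monoˡ-≤ e N<G ⟩
  G ℕ.+ e        ≡⟨ trans G+e≡2n (sym eq) ⟩
  N ℕ.+ suc d    ∎))))
  where open ℕₚ.≤-Reasoning

f-decreasing-above : ∀ n s e G → G ℕ.+ e ≡ n ℕ.+ n → t s e ℕ.≤ B n →
  ∀ N → G ℕ.< N → f n s (suc N) ℕ.≤ f n s N
f-decreasing-above n s e G G+e≡2n t≤B N G<N with ℕₚ.<-≤-connex N (n ℕ.+ n)
... | inj₂ 2n≤N = ℕₚ.≤-trans (ℕₚ.≤-reflexive (N>2n⇒f≡0 n s (s≤s 2n≤N))) z≤n
... | inj₁ N<2n with complement-index N<2n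
...   | d , eq = f-decreasing n s N d eq (ℕₚ.≤-trans (t-mono-≤ s (ℕₚ.+-cancelˡ-≤ G (suc (suc d)) e (begin
  G ℕ.+ suc (suc d)  ≡⟨ ℕₚ.+-suc G (suc d) ⟩
  suc G ℕ.+ suc d    ≤⟨ ℕₚ.+-monoˡ-≤ (suc d) G<N ⟩
  N ℕ.+ suc d        ≡⟨ trans eq (sym G+e≡2n) ⟩
  G ℕ.+ e            ∎))) t≤B)
  where open ℕₚ.≤-Reasoning

-- Floors and square roots

isqrtAux-sound : ∀ m k → isqrtAux m k ℕ.* isqrtAux m k ℕ.≤ m
isqrtAux-sound m zero = z≤n
isqrtAux-sound m (suc k) with suc k ℕ.* suc k ℕ.≤ᵇ m in eq
... | true  = ℕₚ.≤ᵇ⇒≤ (suc k ℕ.* suc k) m (subst T (sym eq) tt)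
... | false = isqrtAux-sound m k

isqrtAux-maximal : ∀ m k j → j ℕ.≤ k → j ℕ.* j ℕ.≤ m → j ℕ.≤ isqrtAux m k
isqrtAux-maximal m zero    j j≤0   _    = j≤0
isqrtAux-maximal m (suc k) j j≤1+k j²≤m with suc k ℕ.* suc k ℕ.≤ᵇ m in eq
... | true  = j≤1+k
... | false with ℕₚ.m≤n⇒m<n∨m≡n j≤1+k
...   | inj₁ (s≤s j≤k) = isqrtAux-maximal m k j j≤k j²≤m
...   | inj₂ refl      = contradiction (ℕₚ.≤⇒≤ᵇ j²≤m) (subst (λ b → ¬ T b) (sym eq) (λ ()))

-- The search in `isqrt` starts at m, and a positive j with j² ≤ m is within its range because j ≤
-- j².
isqrt-maximal : ∀ m j → j ℕ.* j ℕ.≤ m → j ℕ.≤ isqrt m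
isqrt-maximal m zero    _    = z≤n
isqrt-maximal m (suc j) j²≤m = isqrtAux-maximal m m (suc j) (ℕₚ.≤-trans (ℕₚ.m≤m*n (suc j) (suc j)) j²≤m) j²≤m

isqrt-upper : ∀ m → m ℕ.< suc (isqrt m) ℕ.* suc (isqrt m)
isqrt-upper m = ℕₚ.≰⇒> (λ le → ℕₚ.1+n≰n (isqrt-maximal m (suc (isqrt m)) le))

half-unique : ∀ {z q} r → r ℕ.< 2 → z ≡ + r ℤ.+ q ℤ.* + 2 → half⌊ z ⌋ ≡ q
half-unique {z} {q} r r<2 z≡ = ℤₚ.≤-antisym
  (bound half⌊ z ⌋ q _ r r<2 (trans (sym (ℤD.a≡a%n+[a/n]*n z (+ 2))) z≡))
  (bound q half⌊ z ⌋ r _ (ℤD.n%d<d z (+ 2)) (trans (sym z≡) (ℤD.a≡a%n+[a/n]*n z (+ 2))))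
  where
  bound : ∀ q q′ r r′ → r′ ℕ.< 2 → + r ℤ.+ q ℤ.* + 2 ≡ + r′ ℤ.+ q′ ℤ.* + 2 → q ℤ.≤ q′
  bound q q′ r r′ r′<2 eq = subst (q ℤ.≤_) (ℤₚ.pred-suc q′) (ℤₚ.i<j⇒i≤pred[j] {j = ℤ.suc q′}
    (ℤₚ.*-cancelʳ-<-nonNeg {q} {ℤ.suc q′} (+ 2) (begin-strict
      q ℤ.* + 2              ≤⟨ ℤₚ.i≤j+i (q ℤ.* + 2) (+ r) ⟩
      + r ℤ.+ q ℤ.* + 2      ≡⟨ eq ⟩
      + r′ ℤ.+ q′ ℤ.* + 2    <⟨ ℤₚ.+-monoˡ-< (q′ ℤ.* + 2) (ℤ.+<+ r′<2) ⟩
      + 2 ℤ.+ q′ ℤ.* + 2     ≡⟨ sym (ℤₚ.suc-* q′ (+ 2)) ⟩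
      ℤ.suc q′ ℤ.* + 2       ∎)))
    where open ℤₚ.≤-Reasoning

i<j⇒0<j-i : ∀ {i j} → i ℤ.< j → 0ℤ ℤ.< j ℤ.- i
i<j⇒0<j-i {i} {j} i<j = subst (ℤ._< j ℤ.- i) (ℤₚ.+-inverseʳ i) (ℤₚ.+-monoˡ-< (ℤ.- i) i<j)

0<j-i⇒i<j : ∀ {i j} → 0ℤ ℤ.< j ℤ.- i → i ℤ.< j
0<j-i⇒i<j {i} {j} lt = subst₂ ℤ._<_ (ℤₚ.+-identityˡ i) (cancel i j) (ℤₚ.+-monoˡ-< i lt)
  where
  cancel : ∀ i j → j ℤ.- i ℤ.+ i ≡ j
  cancel = ℤ-Solver.solve-∀

-- Integers among the rationals

-- `ℕ→ℚ n` unfolds to `ι (+ n)`, so the laws of `ι` also serve the casts from ℕ.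
ι : ℤ → ℚ
ι z = z ℚ./ 1

-- Among unnormalised fractions there is no reduction to lowest terms, so the laws of `ι` become
-- statements about integers.
toℚᵘ-ι : ∀ z → toℚᵘ (ι z) ℚᵘ.≃ mkℚᵘ z 0
toℚᵘ-ι z = ℚₚ.toℚᵘ-fromℚᵘ (mkℚᵘ z 0)

ι-+ : ∀ a b → ι (a ℤ.+ b) ≡ ι a ℚ.+ ι b
ι-+ a b = ℚₚ.toℚᵘ-injective (begin
  toℚᵘ (ι (a ℤ.+ b))             ≈⟨ toℚᵘ-ι (a ℤ.+ b) ⟩
  mkℚᵘ (a ℤ.+ b) 0               ≈⟨ *≡* (identity a b) ⟩
  mkℚᵘ a 0 ℚᵘ.+ mkℚᵘ b 0         ≈⟨ ℚᵘₚ.+-cong (ℚᵘₚ.≃-sym (toℚᵘ-ι a)) (ℚᵘₚ.≃-sym (toℚᵘ-ι b)) ⟩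
  toℚᵘ (ι a) ℚᵘ.+ toℚᵘ (ι b)     ≈⟨ ℚᵘₚ.≃-sym (ℚₚ.toℚᵘ-homo-+ (ι a) (ι b)) ⟩
  toℚᵘ (ι a ℚ.+ ι b)             ∎)
  where
  open ℚᵘₚ.≃-Reasoning
  identity : ∀ a b → (a ℤ.+ b) ℤ.* 1ℤ ≡ (a ℤ.* 1ℤ ℤ.+ b ℤ.* 1ℤ) ℤ.* 1ℤ
  identity = ℤ-Solver.solve-∀

ι-* : ∀ a b → ι (a ℤ.* b) ≡ ι a ℚ.* ι b
ι-* a b = ℚₚ.toℚᵘ-injective (begin
  toℚᵘ (ι (a ℤ.* b))             ≈⟨ toℚᵘ-ι (a ℤ.* b) ⟩
  mkℚᵘ a 0 ℚᵘ.* mkℚᵘ b 0         ≈⟨ ℚᵘₚ.*-cong (ℚᵘₚ.≃-sym (toℚᵘ-ι a)) (ℚᵘₚ.≃-sym (toℚᵘ-ι b)) ⟩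
  toℚᵘ (ι a) ℚᵘ.* toℚᵘ (ι b)     ≈⟨ ℚᵘₚ.≃-sym (ℚₚ.toℚᵘ-homo-* (ι a) (ι b)) ⟩
  toℚᵘ (ι a ℚ.* ι b)             ∎)
  where open ℚᵘₚ.≃-Reasoning

ι-neg : ∀ a → ι (ℤ.- a) ≡ ℚ.- ι a
ι-neg a = ℚₚ.toℚᵘ-injective (begin
  toℚᵘ (ι (ℤ.- a))         ≈⟨ toℚᵘ-ι (ℤ.- a) ⟩
  ℚᵘ.- mkℚᵘ a 0            ≈⟨ ℚᵘₚ.-‿cong (ℚᵘₚ.≃-sym (toℚᵘ-ι a)) ⟩
  ℚᵘ.- toℚᵘ (ι a)          ≈⟨ ℚᵘₚ.≃-sym (ℚₚ.toℚᵘ-homo‿- (ι a)) ⟩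
  toℚᵘ (ℚ.- ι a)           ∎)
  where open ℚᵘₚ.≃-Reasoning

ι-- : ∀ a b → ι (a ℤ.- b) ≡ ι a ℚ.- ι b
ι-- a b = trans (ι-+ a (ℤ.- b)) (cong (ι a ℚ.+_) (ι-neg b))

ι-mono-≤ : ∀ {a b} → a ℤ.≤ b → ι a ℚ.≤ ι b
ι-mono-≤ {a} {b} a≤b = ℚₚ.toℚᵘ-cancel-≤
  (ℚᵘₚ.≤-respˡ-≃ (ℚᵘₚ.≃-sym (toℚᵘ-ι a)) (ℚᵘₚ.≤-respʳ-≃ (ℚᵘₚ.≃-sym (toℚᵘ-ι b)) (*≤* (ℤₚ.*-monoʳ-≤-nonNeg 1ℤ a≤b))))

ι-cancel-≤ : ∀ {a b} → ι a ℚ.≤ ι b → a ℤ.≤ b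
ι-cancel-≤ {a} {b} le = ℤₚ.*-cancelʳ-≤-pos a b 1ℤ
  (ℚᵘₚ.drop-*≤* (ℚᵘₚ.≤-respˡ-≃ (toℚᵘ-ι a) (ℚᵘₚ.≤-respʳ-≃ (toℚᵘ-ι b) (ℚₚ.toℚᵘ-mono-≤ le))))

ι-mono-< : ∀ {a b} → a ℤ.< b → ι a ℚ.< ι b
ι-mono-< {a} {b} a<b = ℚₚ.toℚᵘ-cancel-<
  (ℚᵘₚ.<-respˡ-≃ (ℚᵘₚ.≃-sym (toℚᵘ-ι a)) (ℚᵘₚ.<-respʳ-≃ (ℚᵘₚ.≃-sym (toℚᵘ-ι b)) (*<* (ℤₚ.*-monoʳ-<-pos 1ℤ a<b))))

ι-cancel-< : ∀ {a b} → ι a ℚ.< ι b → a ℤ.< b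
ι-cancel-< {a} {b} lt = ℤₚ.*-cancelʳ-<-nonNeg 1ℤ
  (ℚᵘₚ.drop-*<* (ℚᵘₚ.<-respˡ-≃ (toℚᵘ-ι a) (ℚᵘₚ.<-respʳ-≃ (toℚᵘ-ι b) (ℚₚ.toℚᵘ-mono-< lt))))

ι≢0 : ∀ {a} → a ≢ 0ℤ → ι a ≢ 0ℚ
ι≢0 a≢0 ιa≡0 = a≢0 (ℤₚ.≤-antisym (ι-cancel-≤ (ℚₚ.≤-reflexive ιa≡0)) (ι-cancel-≤ (ℚₚ.≤-reflexive (sym ιa≡0))))

ι-pos : ∀ {m} → 0 ℕ.< m → ℚ.Positive (ℕ→ℚ m)
ι-pos 0<m = ℚ.positive (ι-mono-< (ℤ.+<+ 0<m))

ℕ→ℚ≢0 : ∀ {m} → 0 ℕ.< m → ℕ→ℚ m ≢ 0ℚ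
ℕ→ℚ≢0 {suc m} (s≤s _) = ι≢0 {+ suc m} (λ ())

/ℚ-* : ∀ u v → v ≢ 0ℚ → (u /ℚ v) ℚ.* v ≡ u
/ℚ-* u v v≢0 with v ℚₚ.≟ 0ℚ
... | yes v≡0 = contradiction v≡0 v≢0
... | no  v≢0 = trans (ℚₚ.*-assoc u (ℚ.1/_ v {{≢-nonZero v≢0}}) v)
  (trans (cong (u ℚ.*_) (ℚₚ.*-inverseˡ v {{≢-nonZero v≢0}})) (ℚₚ.*-identityʳ u))

*-/ℚ : ∀ u v → v ≢ 0ℚ → (u ℚ.* v) /ℚ v ≡ u
*-/ℚ u v v≢0 with v ℚₚ.≟ 0ℚ
... | yes v≡0 = contradiction v≡0 v≢0
... | no  v≢0 = trans (ℚₚ.*-assoc u v (ℚ.1/_ v {{≢-nonZero v≢0}}))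
  (trans (cong (u ℚ.*_) (ℚₚ.*-inverseʳ v {{≢-nonZero v≢0}})) (ℚₚ.*-identityʳ u))

*-cancelʳ-≢0 : ∀ u w v → v ≢ 0ℚ → u ℚ.* v ≡ w ℚ.* v → u ≡ w
*-cancelʳ-≢0 u w v v≢0 eq = trans (sym (*-/ℚ u v v≢0)) (trans (cong (_/ℚ v) eq) (*-/ℚ w v v≢0))

-- P_d at a natural number

falling-ι : ∀ n k → falling (ℕ→ℚ n) k ≡ ℕ→ℚ (fallingℕ n k)
falling-ι n zero    = refl
falling-ι n (suc k) = begin
  falling (ℕ→ℚ n) k ℚ.* (ℕ→ℚ n ℚ.- ℕ→ℚ k)     ≡⟨ cong₂ ℚ._*_ (falling-ι n k) (sym (ι-- (+ n) (+ k))) ⟩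
  ι (+ fallingℕ n k) ℚ.* ι (+ n ℤ.- + k)       ≡⟨ sym (ι-* (+ fallingℕ n k) (+ n ℤ.- + k)) ⟩
  ι (+ fallingℕ n k ℤ.* (+ n ℤ.- + k))         ≡⟨ cong ι monus ⟩
  ι (+ fallingℕ n k ℤ.* + (n ∸ k))             ≡⟨ cong ι (sym (ℤₚ.pos-* (fallingℕ n k) (n ∸ k))) ⟩
  ℕ→ℚ (fallingℕ n k ℕ.* (n ∸ k))               ≡⟨ cong ℕ→ℚ (sym (fallingℕ-suc n k)) ⟩
  ℕ→ℚ (fallingℕ n (suc k))                     ∎
  where
  open ≡-Reasoning
  monus : + fallingℕ n k ℤ.* (+ n ℤ.- + k) ≡ + fallingℕ n k ℤ.* + (n ∸ k)
  monus with ℕₚ.≤-<-connex k n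
  ... | inj₁ k≤n = cong (+ fallingℕ n k ℤ.*_) (trans (ℤₚ.m-n≡m⊖n n k) (ℤₚ.⊖-≥ k≤n))
  -- Beyond n the new factor is negative, but the product is zero already.
  ... | inj₂ n<k rewrite k>n⇒fallingℕ≡0 n<k = refl

ℕ→ℚ-* : ∀ a b → ℕ→ℚ (a ℕ.* b) ≡ ℕ→ℚ a ℚ.* ℕ→ℚ b
ℕ→ℚ-* a b = trans (cong ι (ℤₚ.pos-* a b)) (ι-* (+ a) (+ b))

sumToℚ-ι : ∀ d (h : ℕ → ℚ) (k : ℕ → ℕ) → (∀ i → h i ≡ ℕ→ℚ (k i)) → sumToℚ d h ≡ ℕ→ℚ (sumTo d k)
sumToℚ-ι zero    h k eq = eq 0
sumToℚ-ι (suc d) h k eq = trans (cong₂ ℚ._+_ (sumToℚ-ι d h k eq) (eq (suc d)))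
  (sym (ι-+ (+ sumTo d k) (+ k (suc d))))

-- At x = n, x_i = C(n, i) i!, so (x_i)² / i! = C(n, i) x_i is a rook number.
P-ι : ∀ n d → P d (ℕ→ℚ n) ≡ ℕ→ℚ (pℕ n d)
P-ι n d = sumToℚ-ι d _ (λ i → rook n i ℕ.* rook n (d ∸ i)) (λ i → summand i (d ∸ i))
  where
  open ≡-Reasoning
  regroup : ∀ c u b v → (c ℕ.* u) ℕ.* (c ℕ.* u) ℕ.* (b ℕ.* v) ℕ.* (b ℕ.* v)
    ≡ c ℕ.* (c ℕ.* u) ℕ.* (b ℕ.* (b ℕ.* v)) ℕ.* (u ℕ.* v)
  regroup = ℕ-Solver.solve-∀
  summand : ∀ i j → (falling (ℕ→ℚ n) i ℚ.* falling (ℕ→ℚ n) i ℚ.* falling (ℕ→ℚ n) j ℚ.* falling (ℕ→ℚ n) j)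
    /ℚ ℕ→ℚ (i ! ℕ.* j !) ≡ ℕ→ℚ (rook n i ℕ.* rook n j)
  summand i j = trans (cong (_/ℚ ℕ→ℚ (i ! ℕ.* j !)) numerator)
    (*-/ℚ _ _ (ℕ→ℚ≢0 (ℕₚ.n≢0⇒n>0 (ℕ.≢-nonZero⁻¹ (i ! ℕ.* j !) {{i ℕₚ.!* j !≢0}}))))
    where
    a = fallingℕ n i
    b = fallingℕ n j
    numerator : falling (ℕ→ℚ n) i ℚ.* falling (ℕ→ℚ n) i ℚ.* falling (ℕ→ℚ n) j ℚ.* falling (ℕ→ℚ n) j
      ≡ ℕ→ℚ (rook n i ℕ.* rook n j) ℚ.* ℕ→ℚ (i ! ℕ.* j !)
    numerator = begin
      falling (ℕ→ℚ n) i ℚ.* falling (ℕ→ℚ n) i ℚ.* falling (ℕ→ℚ n) j ℚ.* falling (ℕ→ℚ n) j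
        ≡⟨ cong₂ (λ u v → u ℚ.* u ℚ.* v ℚ.* v) (falling-ι n i) (falling-ι n j) ⟩
      ℕ→ℚ a ℚ.* ℕ→ℚ a ℚ.* ℕ→ℚ b ℚ.* ℕ→ℚ b
        ≡⟨ cong (λ v → v ℚ.* ℕ→ℚ b ℚ.* ℕ→ℚ b) (sym (ℕ→ℚ-* a a)) ⟩
      ℕ→ℚ (a ℕ.* a) ℚ.* ℕ→ℚ b ℚ.* ℕ→ℚ b
        ≡⟨ cong (ℚ._* ℕ→ℚ b) (sym (ℕ→ℚ-* (a ℕ.* a) b)) ⟩
      ℕ→ℚ (a ℕ.* a ℕ.* b) ℚ.* ℕ→ℚ b
        ≡⟨ sym (ℕ→ℚ-* (a ℕ.* a ℕ.* b) b) ⟩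
      ℕ→ℚ (a ℕ.* a ℕ.* b ℕ.* b)
        ≡⟨ cong ℕ→ℚ (regroup (n C i) (i !) (n C j) (j !)) ⟩
      ℕ→ℚ (rook n i ℕ.* rook n j ℕ.* (i ! ℕ.* j !))
        ≡⟨ ℕ→ℚ-* (rook n i ℕ.* rook n j) (i ! ℕ.* j !) ⟩
      ℕ→ℚ (rook n i ℕ.* rook n j) ℚ.* ℕ→ℚ (i ! ℕ.* j !) ∎

-- The condition on d₀

module _ (n s d : ℕ) where
  open import Data.Rational using (_+_; _*_; _-_; -_; _≤_; _<_)
  open ℚS.+-*-Solver

  private
    x = ℕ→ℚ n
    D = ℕ→ℚ (suc d)
    u = ℕ→ℚ 2 /ℚ D
    v = ℕ→ℚ (d ℕ.+ 2) /ℚ ℕ→ℚ 2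
    u′ = ℕ→ℚ (2 ℕ.* d) /ℚ D
    v′ = ℕ→ℚ d /ℚ ℕ→ℚ 2

  -- Unfolds to the middle term of `CondAt`.
  c : ℚ
  c = u * (x * x + x) - v - ℕ→ℚ s

  private
    D≢0 : D ≢ 0ℚ
    D≢0 = ℕ→ℚ≢0 {suc d} (s≤s z≤n)
    2≢0 : ℕ→ℚ 2 ≢ 0ℚ
    2≢0 = ℕ→ℚ≢0 {2} (s≤s z≤n)

    ℚ-identity : ∀ u v x s D two → (u * (x * x + x) - v - s) * (D * two)
      ≡ (u * D) * (x * x + x) * two - (v * two) * D - s * (D * two)
    ℚ-identity = solve 6 (λ u v x s D two → (u :* (x :* x :+ x) :- v :- s) :* (D :* two)
      := (u :* D) :* (x :* x :+ x) :* two :- (v :* two) :* D :- s :* (D :* two)) refl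

    ℤ-identity : ∀ n s d → + 2 ℤ.* (n ℤ.* n ℤ.+ n) ℤ.* + 2 ℤ.- (d ℤ.+ + 2) ℤ.* (1ℤ ℤ.+ d) ℤ.- s ℤ.* ((1ℤ ℤ.+ d) ℤ.* + 2)
      ≡ (+ 4 ℤ.* n ℤ.* n ℤ.+ + 4 ℤ.* n) ℤ.- ((1ℤ ℤ.+ d) ℤ.* (1ℤ ℤ.+ d) ℤ.+ (1ℤ ℤ.+ d) ℤ.* (+ 2 ℤ.* s ℤ.+ 1ℤ))
    ℤ-identity = ℤ-Solver.solve-∀

  -- Clearing the denominators d + 1 and 2 turns the sign of c into a comparison of `t s (suc d)`
  -- with `B n`.
  c-scaled : c * (D * ℕ→ℚ 2) ≡ ι (+ B n ℤ.- + t s (suc d))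
  c-scaled = begin
    c * (D * ℕ→ℚ 2)
      ≡⟨ ℚ-identity u v x (ℕ→ℚ s) D (ℕ→ℚ 2) ⟩
    (u * D) * (x * x + x) * ℕ→ℚ 2 - (v * ℕ→ℚ 2) * D - ℕ→ℚ s * (D * ℕ→ℚ 2)
      ≡⟨ cong₂ (λ y z → y * (x * x + x) * ℕ→ℚ 2 - z * D - ℕ→ℚ s * (D * ℕ→ℚ 2)) (/ℚ-* (ℕ→ℚ 2) D D≢0) (/ℚ-* (ℕ→ℚ (d ℕ.+ 2)) (ℕ→ℚ 2) 2≢0) ⟩
    ι (+ 2) * (ι (+ n) * ι (+ n) + ι (+ n)) * ι (+ 2) - ι (+ (d ℕ.+ 2)) * ι (+ suc d) - ι (+ s) * (ι (+ suc d) * ι (+ 2))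
      ≡⟨ cong₂ (λ y z → y - z - ι (+ s) * (ι (+ suc d) * ι (+ 2))) first (sym (ι-* (+ (d ℕ.+ 2)) (+ suc d))) ⟩
    ι A₁ - ι A₂ - ι (+ s) * (ι (+ suc d) * ι (+ 2))
      ≡⟨ cong₂ _-_ (sym (ι-- A₁ A₂)) third ⟩
    ι (A₁ ℤ.- A₂) - ι A₃
      ≡⟨ sym (ι-- (A₁ ℤ.- A₂) A₃) ⟩
    ι (A₁ ℤ.- A₂ ℤ.- A₃)
      ≡⟨ cong ι (trans (ℤ-identity (+ n) (+ s) (+ d)) (sym (cong₂ ℤ._-_ (B-cast n) (t-cast s (suc d))))) ⟩
    ι (+ B n ℤ.- + t s (suc d)) ∎
    where
    open ≡-Reasoning
    A₁ = + 2 ℤ.* (+ n ℤ.* + n ℤ.+ + n) ℤ.* + 2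
    A₂ = + (d ℕ.+ 2) ℤ.* + suc d
    A₃ = + s ℤ.* (+ suc d ℤ.* + 2)
    first : ι (+ 2) * (ι (+ n) * ι (+ n) + ι (+ n)) * ι (+ 2) ≡ ι A₁
    first = sym (trans (ι-* (+ 2 ℤ.* (+ n ℤ.* + n ℤ.+ + n)) (+ 2)) (cong (_* ι (+ 2))
      (trans (ι-* (+ 2) (+ n ℤ.* + n ℤ.+ + n)) (cong (ι (+ 2) *_)
        (trans (ι-+ (+ n ℤ.* + n) (+ n)) (cong (_+ ι (+ n)) (ι-* (+ n) (+ n))))))))
    third : ι (+ s) * (ι (+ suc d) * ι (+ 2)) ≡ ι A₃
    third = sym (trans (ι-* (+ s) (+ suc d ℤ.* + 2)) (cong (ι (+ s) *_) (ι-* (+ suc d) (+ 2))))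

  private
    2D-pos : ℚ.Positive (D * ℕ→ℚ 2)
    2D-pos = ℚₚ.pos*pos⇒pos D {{ι-pos {suc d} (s≤s z≤n)}} (ℕ→ℚ 2) {{ι-pos {2} (s≤s z≤n)}}

  0<c⇒t<B : 0ℚ < c → t s (suc d) ℕ.< B n
  0<c⇒t<B 0<c = ℤₚ.drop‿+<+ (0<j-i⇒i<j (ι-cancel-< (subst₂ _<_ (ℚₚ.*-zeroˡ (D * ℕ→ℚ 2)) c-scaled
    (ℚₚ.*-monoˡ-<-pos (D * ℕ→ℚ 2) {{2D-pos}} 0<c))))

  t<B⇒0<c : t s (suc d) ℕ.< B n → 0ℚ < c
  t<B⇒0<c t<B = ℚₚ.*-cancelʳ-<-nonNeg (D * ℕ→ℚ 2) {{ℚₚ.pos⇒nonNeg (D * ℕ→ℚ 2) {{2D-pos}}}}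
    (subst₂ _<_ (sym (ℚₚ.*-zeroˡ (D * ℕ→ℚ 2))) (sym c-scaled) (ι-mono-< (i<j⇒0<j-i (ℤ.+<+ t<B))))

  module _ (N : ℕ) (N+d+1≡2n : N ℕ.+ suc d ≡ n ℕ.+ n) where

    -- The quadratic terms cancel. The constants d/2 and (d + 2)/2 add up to d + 1, the linear
    -- coefficients 2d/(d + 1) and 2/(d + 1) to 2, and s + d + 1 - 2n is s - N.
    Q-c : Q d x - c ≡ ι (+ s ℤ.- + N)
    Q-c = begin
      u * x * x - u′ * x + v′ - (u * (x * x + x) - v - ℕ→ℚ s)
        ≡⟨ identity u u′ v v′ x (ℕ→ℚ s) ⟩
      (v′ + v) + ℕ→ℚ s - (u′ + u) * x
        ≡⟨ cong₂ (λ y z → y + ℕ→ℚ s - z * x) v′+v≡D u′+u≡2 ⟩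
      ι (+ suc d) + ι (+ s) - ι (+ 2) * ι (+ n)
        ≡⟨ cong₂ _-_ (sym (ι-+ (+ suc d) (+ s))) (sym (ι-* (+ 2) (+ n))) ⟩
      ι (+ suc d ℤ.+ + s) - ι (+ 2 ℤ.* + n)
        ≡⟨ sym (ι-- (+ suc d ℤ.+ + s) (+ 2 ℤ.* + n)) ⟩
      ι (+ suc d ℤ.+ + s ℤ.- + 2 ℤ.* + n)
        ≡⟨ cong ι (trans (ℤ-identity′ (+ n) (+ s) (+ suc d)) (cong (λ w → + s ℤ.- w) (sym (+-cast-∸ N (suc d) N+d+1≡2n)))) ⟩
      ι (+ s ℤ.- + N) ∎
      where
      open ≡-Reasoning
      identity : ∀ u u′ v v′ x s → u * x * x - u′ * x + v′ - (u * (x * x + x) - v - s) ≡ (v′ + v) + s - (u′ + u) * x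
      identity = solve 6 (λ u u′ v v′ x s → u :* x :* x :- u′ :* x :+ v′ :- (u :* (x :* x :+ x) :- v :- s)
        := (v′ :+ v) :+ s :- (u′ :+ u) :* x) refl
      ℤ-identity′ : ∀ n s e → e ℤ.+ s ℤ.- + 2 ℤ.* n ≡ s ℤ.- (n ℤ.+ n ℤ.- e)
      ℤ-identity′ = ℤ-Solver.solve-∀
      u′+u≡2 : u′ + u ≡ ι (+ 2)
      u′+u≡2 = *-cancelʳ-≢0 (u′ + u) (ι (+ 2)) D D≢0 (begin
        (u′ + u) * D                       ≡⟨ ℚₚ.*-distribʳ-+ D u′ u ⟩
        u′ * D + u * D                     ≡⟨ cong₂ _+_ (/ℚ-* (ℕ→ℚ (2 ℕ.* d)) D D≢0) (/ℚ-* (ℕ→ℚ 2) D D≢0) ⟩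
        ι (+ (2 ℕ.* d)) + ι (+ 2)          ≡⟨ sym (ι-+ (+ (2 ℕ.* d)) (+ 2)) ⟩
        ℕ→ℚ (2 ℕ.* d ℕ.+ 2)                ≡⟨ cong ℕ→ℚ (2d+2 d) ⟩
        ℕ→ℚ (2 ℕ.* suc d)                  ≡⟨ ℕ→ℚ-* 2 (suc d) ⟩
        ι (+ 2) * D                        ∎)
        where
        2d+2 : ∀ d → 2 ℕ.* d ℕ.+ 2 ≡ 2 ℕ.* (1 ℕ.+ d)
        2d+2 = ℕ-Solver.solve-∀
      v′+v≡D : v′ + v ≡ D
      v′+v≡D = *-cancelʳ-≢0 (v′ + v) D (ℕ→ℚ 2) 2≢0 (begin
        (v′ + v) * ℕ→ℚ 2                   ≡⟨ ℚₚ.*-distribʳ-+ (ℕ→ℚ 2) v′ v ⟩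
        v′ * ℕ→ℚ 2 + v * ℕ→ℚ 2             ≡⟨ cong₂ _+_ (/ℚ-* (ℕ→ℚ d) (ℕ→ℚ 2) 2≢0) (/ℚ-* (ℕ→ℚ (d ℕ.+ 2)) (ℕ→ℚ 2) 2≢0) ⟩
        ι (+ d) + ι (+ (d ℕ.+ 2))          ≡⟨ sym (ι-+ (+ d) (+ (d ℕ.+ 2))) ⟩
        ℕ→ℚ (d ℕ.+ (d ℕ.+ 2))              ≡⟨ cong ℕ→ℚ (2d+2 d) ⟩
        ℕ→ℚ (suc d ℕ.* 2)                  ≡⟨ ℕ→ℚ-* (suc d) 2 ⟩
        D * ℕ→ℚ 2                          ∎)
        where
        2d+2 : ∀ d → d ℕ.+ (d ℕ.+ 2) ≡ (1 ℕ.+ d) ℕ.* 2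
        2d+2 = ℕ-Solver.solve-∀

    private
      p>0 : 0 ℕ.< pℕ n d
      p>0 = pℕ>0 n d (ℕₚ.≤-trans (ℕₚ.n≤1+n d) (ℕₚ.≤-trans (ℕₚ.m≤n+m (suc d) N) (ℕₚ.≤-reflexive N+d+1≡2n)))
      p₀ = ι (+ pℕ n d)
      p₁ = ι (+ pℕ n (suc d))
      r = R d x /ℚ P d x

      -- As P_d(n) > 0, r is a true quotient and not the default value of `_/ℚ_`.
      r*p₀ : r * p₀ ≡ p₁ - Q d x * p₀
      r*p₀ = trans (cong (λ w → (R d x /ℚ w) * p₀) (P-ι n d))
        (trans (/ℚ-* (R d x) p₀ (ℕ→ℚ≢0 p>0)) (cong₂ (λ y z → y - Q d x * z) (P-ι n (suc d)) (P-ι n d)))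

      -- Q_d enters only through Q_d - c = s - N, so the sign of - r - c is that of (s - N) P_d -
      -- P_{d+1}.
      gap : - r * p₀ - c * p₀ ≡ ι ((+ s ℤ.- + N) ℤ.* + pℕ n d) - p₁
      gap = begin
        - r * p₀ - c * p₀                           ≡⟨ identity r c p₀ ⟩
        - (r * p₀) - c * p₀                         ≡⟨ cong (λ w → - w - c * p₀) r*p₀ ⟩
        - (p₁ - Q d x * p₀) - c * p₀                ≡⟨ identity′ p₀ p₁ (Q d x) c ⟩
        (Q d x - c) * p₀ - p₁                       ≡⟨ cong (λ w → w * p₀ - p₁) Q-c ⟩
        ι (+ s ℤ.- + N) * p₀ - p₁                   ≡⟨ cong (_- p₁) (sym (ι-* (+ s ℤ.- + N) (+ pℕ n d))) ⟩
        ι ((+ s ℤ.- + N) ℤ.* + pℕ n d) - p₁         ∎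
        where
        open ≡-Reasoning
        identity : ∀ r c p → - r * p - c * p ≡ - (r * p) - c * p
        identity = solve 3 (λ r c p → :- r :* p :- c :* p := :- (r :* p) :- c :* p) refl
        identity′ : ∀ p₀ p₁ q c → - (p₁ - q * p₀) - c * p₀ ≡ (q - c) * p₀ - p₁
        identity′ = solve 4 (λ p₀ p₁ q c → :- (p₁ :- q :* p₀) :- c :* p₀ := (q :- c) :* p₀ :- p₁) refl

      p≤q⇒0≤q-p : ∀ {p q} → p ≤ q → 0ℚ ≤ q - p
      p≤q⇒0≤q-p {p} {q} p≤q = subst (_≤ q - p) (ℚₚ.+-inverseʳ p) (ℚₚ.+-monoˡ-≤ (- p) p≤q)

      0≤q-p⇒p≤q : ∀ {p q} → 0ℚ ≤ q - p → p ≤ q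
      0≤q-p⇒p≤q {p} {q} 0≤q-p = subst₂ _≤_ (ℚₚ.+-identityˡ p) (cancel p q) (ℚₚ.+-monoˡ-≤ p 0≤q-p)
        where
        cancel : ∀ p q → q - p + p ≡ q
        cancel = solve 2 (λ p q → q :- p :+ p := q) refl

    c≤-r⇒step : c ≤ - r → + pℕ n (suc d) ℤ.≤ (+ s ℤ.- + N) ℤ.* + pℕ n d
    c≤-r⇒step c≤-r = ι-cancel-≤ (0≤q-p⇒p≤q (subst (0ℚ ≤_) gap
      (p≤q⇒0≤q-p (ℚₚ.*-monoʳ-≤-nonNeg p₀ {{ℚₚ.pos⇒nonNeg p₀ {{ι-pos p>0}}}} c≤-r))))

    step⇒c≤-r : + pℕ n (suc d) ℤ.≤ (+ s ℤ.- + N) ℤ.* + pℕ n d → c ≤ - r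
    step⇒c≤-r step = ℚₚ.*-cancelʳ-≤-pos p₀ {{ι-pos p>0}} (0≤q-p⇒p≤q (subst (0ℚ ≤_) (sym gap)
      (p≤q⇒0≤q-p (ι-mono-≤ step))))

    CondAt⇔ : CondAt n s d ⇔ (t s (suc d) ℕ.< B n × + pℕ n (suc d) ℤ.≤ (+ s ℤ.- + N) ℤ.* + pℕ n d)
    CondAt⇔ = mk⇔ (λ (0<c , c≤-r) → 0<c⇒t<B 0<c , c≤-r⇒step c≤-r)
                  (λ (t<B , step) → t<B⇒0<c t<B , step⇒c≤-r step)

-- The maximum against the floor expression

open import Data.Nat using (_≤_)
open import Data.Integer using (_+_)

isqrtCeil-square : ∀ m → isqrt m ℕ.* isqrt m ≡ m → isqrtCeil m ≡ isqrt m
isqrtCeil-square m sq with isqrt m ℕ.* isqrt m ℕ.≟ m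
... | yes _  = refl
... | no ¬sq = contradiction sq ¬sq

isqrtCeil-nonsquare : ∀ m → isqrt m ℕ.* isqrt m ≢ m → isqrtCeil m ≡ suc (isqrt m)
isqrtCeil-nonsquare m ¬sq with isqrt m ℕ.* isqrt m ℕ.≟ m
... | yes sq = contradiction sq ¬sq
... | no _   = refl

-- The square root of M in terms of `t` and `B`

M-as-B : ∀ n s → M n s ≡ 4 ℕ.* B n ℕ.+ (2 ℕ.* s ℕ.+ 1) ℕ.* (2 ℕ.* s ℕ.+ 1)
M-as-B n s = identity n (2 ℕ.* s ℕ.+ 1)
  where
  identity : ∀ n u → 16 ℕ.* n ℕ.* n ℕ.+ 16 ℕ.* n ℕ.+ u ℕ.* u ≡ 4 ℕ.* (4 ℕ.* n ℕ.* n ℕ.+ 4 ℕ.* n) ℕ.+ u ℕ.* u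
  identity = ℕ-Solver.solve-∀

-- Together with `M-as-B`, this makes comparing `t s e` with `B n` the same as comparing (2s + 1 +
-- 2e)² with M.
square-as-t : ∀ s e → (2 ℕ.* s ℕ.+ 1 ℕ.+ (e ℕ.+ e)) ℕ.* (2 ℕ.* s ℕ.+ 1 ℕ.+ (e ℕ.+ e))
  ≡ 4 ℕ.* t s e ℕ.+ (2 ℕ.* s ℕ.+ 1) ℕ.* (2 ℕ.* s ℕ.+ 1)
square-as-t s e = identity e (2 ℕ.* s ℕ.+ 1)
  where
  identity : ∀ e u → (u ℕ.+ (e ℕ.+ e)) ℕ.* (u ℕ.+ (e ℕ.+ e)) ≡ 4 ℕ.* (e ℕ.* e ℕ.+ e ℕ.* u) ℕ.+ u ℕ.* u
  identity = ℕ-Solver.solve-∀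

4*+-cancel-≤ : ∀ {a b} c → 4 ℕ.* a ℕ.+ c ≤ 4 ℕ.* b ℕ.+ c → a ≤ b
4*+-cancel-≤ {a} {b} c le = ℕₚ.*-cancelˡ-≤ 4 (ℕₚ.+-cancelʳ-≤ c (4 ℕ.* a) (4 ℕ.* b) le)

-- The digits of ⌊√M⌋ = 2s + 1 + 2e + r, so that d₀ = e - 1.
record RootDigits (n s : ℕ) : Set where
  field
    e r   : ℕ
    r<2   : r ℕ.< 2
    root  : isqrt (M n s) ≡ 2 ℕ.* s ℕ.+ 1 ℕ.+ (r ℕ.+ (e ℕ.+ e))
    t≤B   : t s e ≤ B n
    B<t   : B n ℕ.< t s (suc e)

-- Halving ⌊√M⌋ - (2s + 1) gives 2s + 1 + 2e ≤ ⌊√M⌋ < 2s + 1 + 2 (e + 1); squaring gives the two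
-- bounds.
rootDigits : ∀ n s → RootDigits n s
rootDigits n s = record
  { e = e ; r = r ; r<2 = ℕD.m%n<n k 2 ; root = root
  ; t≤B = 4*+-cancel-≤ (u ℕ.* u) (begin
      4 ℕ.* t s e ℕ.+ u ℕ.* u                    ≡⟨ sym (square-as-t s e) ⟩
      (u ℕ.+ (e ℕ.+ e)) ℕ.* (u ℕ.+ (e ℕ.+ e))    ≤⟨ ℕₚ.*-mono-≤ below below ⟩
      m ℕ.* m                                    ≤⟨ isqrtAux-sound (M n s) (M n s) ⟩
      M n s                                      ≡⟨ M-as-B n s ⟩
      4 ℕ.* B n ℕ.+ u ℕ.* u                      ∎)
  ; B<t = ℕₚ.≰⇒> λ t≤B → ℕₚ.<-irrefl refl (begin-strict
      M n s                                      <⟨ isqrt-upper (M n s) ⟩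
      suc m ℕ.* suc m                            ≤⟨ ℕₚ.*-mono-≤ above above ⟩
      (u ℕ.+ (suc e ℕ.+ suc e)) ℕ.* (u ℕ.+ (suc e ℕ.+ suc e)) ≡⟨ square-as-t s (suc e) ⟩
      4 ℕ.* t s (suc e) ℕ.+ u ℕ.* u              ≤⟨ ℕₚ.+-monoˡ-≤ (u ℕ.* u) (ℕₚ.*-monoʳ-≤ 4 t≤B) ⟩
      4 ℕ.* B n ℕ.+ u ℕ.* u                      ≡⟨ sym (M-as-B n s) ⟩
      M n s                                      ∎)
  }
  where
  open ℕₚ.≤-Reasoning
  u = 2 ℕ.* s ℕ.+ 1
  m = isqrt (M n s)
  u≤m : u ≤ m
  u≤m = isqrt-maximal (M n s) u (ℕₚ.m≤n+m (u ℕ.* u) (16 ℕ.* n ℕ.* n ℕ.+ 16 ℕ.* n))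
  k = m ∸ u
  e = k ℕ./ 2
  r = k ℕ.% 2
  double : ∀ e → e ℕ.* 2 ≡ e ℕ.+ e
  double = ℕ-Solver.solve-∀
  root : m ≡ u ℕ.+ (r ℕ.+ (e ℕ.+ e))
  root = trans (sym (ℕₚ.m+[n∸m]≡n u≤m))
    (cong (u ℕ.+_) (trans (ℕD.m≡m%n+[m/n]*n k 2) (cong (r ℕ.+_) (double e))))
  below : u ℕ.+ (e ℕ.+ e) ≤ m
  below = ℕₚ.≤-trans (ℕₚ.+-monoʳ-≤ u (ℕₚ.m≤n+m (e ℕ.+ e) r)) (ℕₚ.≤-reflexive (sym root))
  shift : ∀ u e → 1 ℕ.+ (u ℕ.+ (1 ℕ.+ (e ℕ.+ e))) ≡ u ℕ.+ ((1 ℕ.+ e) ℕ.+ (1 ℕ.+ e))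
  shift = ℕ-Solver.solve-∀
  above : suc m ≤ u ℕ.+ (suc e ℕ.+ suc e)
  above = begin
    suc m                                ≡⟨ cong suc root ⟩
    suc (u ℕ.+ (r ℕ.+ (e ℕ.+ e)))        ≤⟨ s≤s (ℕₚ.+-monoʳ-≤ u (ℕₚ.+-monoˡ-≤ (e ℕ.+ e) (ℕₚ.≤-pred (ℕD.m%n<n k 2)))) ⟩
    suc (u ℕ.+ (1 ℕ.+ (e ℕ.+ e)))        ≡⟨ shift u e ⟩
    u ℕ.+ (suc e ℕ.+ suc e)              ∎

module _ (n s : ℕ) (digits : RootDigits n s) where
  open RootDigits digits

  private
    u = 2 ℕ.* s ℕ.+ 1

  -- Otherwise t s e ≥ e² ≥ (2n + 1)² > B n.
  e≤2n : e ≤ n ℕ.+ n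
  e≤2n = ℕₚ.≮⇒≥ λ 2n<e → ℕₚ.<-irrefl refl (begin-strict
    B n                          <⟨ ℕₚ.n<1+n (B n) ⟩
    suc (B n)                    ≡⟨ square n ⟩
    suc (n ℕ.+ n) ℕ.* suc (n ℕ.+ n) ≤⟨ ℕₚ.*-mono-≤ 2n<e 2n<e ⟩
    e ℕ.* e                      ≤⟨ ℕₚ.m≤m+n (e ℕ.* e) (e ℕ.* u) ⟩
    t s e                        ≤⟨ t≤B ⟩
    B n                          ∎)
    where
    open ℕₚ.≤-Reasoning
    square : ∀ n → 1 ℕ.+ (4 ℕ.* n ℕ.* n ℕ.+ 4 ℕ.* n) ≡ (1 ℕ.+ (n ℕ.+ n)) ℕ.* (1 ℕ.+ (n ℕ.+ n))
    square = ℕ-Solver.solve-∀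

  d₀-value : d₀ n s ≡ + e ℤ.- 1ℤ
  d₀-value = half-unique r r<2 (trans (cong (λ m → + m ℤ.- + (2 ℕ.* s ℕ.+ 3)) root)
    (identity (+ (2 ℕ.* s)) (+ r) (+ e)))
    where
    identity : ∀ a r e → a ℤ.+ 1ℤ ℤ.+ (r ℤ.+ (e ℤ.+ e)) ℤ.- (a ℤ.+ + 3) ≡ r ℤ.+ (e ℤ.- 1ℤ) ℤ.* + 2
    identity = ℤ-Solver.solve-∀

  square⇒t≡B : isqrt (M n s) ℕ.* isqrt (M n s) ≡ M n s → r ≡ 0 → t s e ≡ B n
  square⇒t≡B sq r≡0 = ℕₚ.*-cancelˡ-≡ (t s e) (B n) 4 (ℕₚ.+-cancelʳ-≡ (u ℕ.* u) (4 ℕ.* t s e) (4 ℕ.* B n) (begin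
    4 ℕ.* t s e ℕ.+ u ℕ.* u                    ≡⟨ sym (square-as-t s e) ⟩
    (u ℕ.+ (e ℕ.+ e)) ℕ.* (u ℕ.+ (e ℕ.+ e))    ≡⟨ cong (λ m → m ℕ.* m) (sym root′) ⟩
    isqrt (M n s) ℕ.* isqrt (M n s)            ≡⟨ sq ⟩
    M n s                                      ≡⟨ M-as-B n s ⟩
    4 ℕ.* B n ℕ.+ u ℕ.* u                      ∎))
    where
    open ≡-Reasoning
    root′ : isqrt (M n s) ≡ u ℕ.+ (e ℕ.+ e)
    root′ = trans root (cong (λ r → u ℕ.+ (r ℕ.+ (e ℕ.+ e))) r≡0)

  t≡B⇒root : t s e ≡ B n → isqrt (M n s) ≡ u ℕ.+ (e ℕ.+ e)
  t≡B⇒root t≡B = ℕₚ.≤-antisym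
    (ℕₚ.≮⇒≥ λ lt → ℕₚ.<-irrefl refl (ℕₚ.<-≤-trans (ℕₚ.*-mono-< lt lt)
      (ℕₚ.≤-trans (isqrtAux-sound (M n s) (M n s)) (ℕₚ.≤-reflexive (sym square)))))
    (isqrt-maximal (M n s) (u ℕ.+ (e ℕ.+ e)) (ℕₚ.≤-reflexive square))
    where
    square : (u ℕ.+ (e ℕ.+ e)) ℕ.* (u ℕ.+ (e ℕ.+ e)) ≡ M n s
    square = trans (square-as-t s e) (trans (cong (λ b → 4 ℕ.* b ℕ.+ u ℕ.* u) t≡B) (sym (M-as-B n s)))

  module _ (G : ℕ) (G+e≡2n : G ℕ.+ e ≡ n ℕ.+ n) where

    floorExpr-ceil : ∀ c r′ {q} → r′ ℕ.< 2 → isqrtCeil (M n s) ≡ c →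
      + G + + e + (+ G + + e) + + (2 ℕ.* s) + + 3 ℤ.- + c ≡ + r′ + q ℤ.* + 2 → floorExpr n s ≡ q
    floorExpr-ceil c r′ r′<2 ceil≡c eq = half-unique r′ r′<2
      (trans (cong₂ (λ m c → + (m ℕ.+ 2 ℕ.* s ℕ.+ 3) ℤ.- + c) 4n≡ ceil≡c) eq)
      where
      4n≡ : 4 ℕ.* n ≡ G ℕ.+ e ℕ.+ (G ℕ.+ e)
      4n≡ = trans (double n) (cong (λ m → m ℕ.+ m) (sym G+e≡2n))
        where
        double : ∀ n → 4 ℕ.* n ≡ n ℕ.+ n ℕ.+ (n ℕ.+ n)
        double = ℕ-Solver.solve-∀

    -- Here ⌈√M⌉ = 2s + 1 + 2e + ρ with ρ = 1 or 2, and 4n + 2s + 3 - ⌈√M⌉ = 2G + (2 - ρ).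
    floorExpr-strict : t s e ≢ B n → floorExpr n s ≡ + G
    floorExpr-strict t≢B = by-square (isqrt (M n s) ℕ.* isqrt (M n s) ℕ.≟ M n s)
      where
      floor′ : ∀ ρ r′ → r′ ℕ.< 2 → isqrtCeil (M n s) ≡ u ℕ.+ (ρ ℕ.+ (e ℕ.+ e)) → ρ ℕ.+ r′ ≡ 2 → floorExpr n s ≡ + G
      floor′ ρ r′ r′<2 ceil ρ+r′≡2 = floorExpr-ceil _ r′ r′<2 ceil
        (trans (cong (λ v → + G + + e + (+ G + + e) + + (2 ℕ.* s) + (1ℤ + + v) ℤ.- + (u ℕ.+ (ρ ℕ.+ (e ℕ.+ e)))) (sym ρ+r′≡2))
          (identity (+ G) (+ e) (+ (2 ℕ.* s)) (+ ρ) (+ r′)))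
        where
        identity : ∀ g e a ρ r′ → g ℤ.+ e ℤ.+ (g ℤ.+ e) ℤ.+ a ℤ.+ (1ℤ ℤ.+ (ρ ℤ.+ r′)) ℤ.- (a ℤ.+ 1ℤ ℤ.+ (ρ ℤ.+ (e ℤ.+ e)))
          ≡ r′ ℤ.+ g ℤ.* + 2
        identity = ℤ-Solver.solve-∀
      by-digit : ∀ r → r ℕ.< 2 → isqrtCeil (M n s) ≡ u ℕ.+ (suc r ℕ.+ (e ℕ.+ e)) → floorExpr n s ≡ + G
      by-digit zero          _             ceil = floor′ 1 1 (s≤s (s≤s z≤n)) ceil refl
      by-digit (suc zero)    _             ceil = floor′ 2 0 (s≤s z≤n) ceil refl
      by-digit (suc (suc _)) (s≤s (s≤s ()))
      by-square : _ → floorExpr n s ≡ + G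
      by-square (no ¬sq) = by-digit r r<2 (trans (isqrtCeil-nonsquare (M n s) ¬sq)
        (trans (cong suc root) (sym (ℕₚ.+-suc u (r ℕ.+ (e ℕ.+ e))))))
      by-square (yes sq) = odd-digit r r<2 refl
        where
        odd-digit : ∀ ρ → ρ ℕ.< 2 → r ≡ ρ → floorExpr n s ≡ + G
        odd-digit zero          _ r≡0 = contradiction (square⇒t≡B sq r≡0) t≢B
        odd-digit (suc zero)    _ r≡1 = floor′ 1 1 (s≤s (s≤s z≤n)) (trans (isqrtCeil-square (M n s) sq)
          (trans root (cong (λ r → u ℕ.+ (r ℕ.+ (e ℕ.+ e))) r≡1))) refl
        odd-digit (suc (suc _)) (s≤s (s≤s ()))

    -- Here √M is exactly 2s + 1 + 2e; the numerator is 2G + 2.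
    floorExpr-tie : t s e ≡ B n → floorExpr n s ≡ + suc G
    floorExpr-tie t≡B = floorExpr-ceil _ 0 (s≤s z≤n)
      (trans (isqrtCeil-square (M n s) square) (t≡B⇒root t≡B))
      (identity (+ G) (+ e) (+ (2 ℕ.* s)))
      where
      identity : ∀ g e a → g ℤ.+ e ℤ.+ (g ℤ.+ e) ℤ.+ a ℤ.+ + 3 ℤ.- (a ℤ.+ 1ℤ ℤ.+ (e ℤ.+ e)) ≡ 0ℤ ℤ.+ (1ℤ ℤ.+ g) ℤ.* + 2
      identity = ℤ-Solver.solve-∀
      square : isqrt (M n s) ℕ.* isqrt (M n s) ≡ M n s
      square = trans (cong (λ m → m ℕ.* m) (t≡B⇒root t≡B)) (trans (square-as-t s e)
        (trans (cong (λ b → 4 ℕ.* b ℕ.+ u ℕ.* u) t≡B) (sym (M-as-B n s))))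

-- The maximum and the condition, case by case

Cond-nonneg : ∀ n s {d} → d₀ n s ≡ + d → Cond n s ≡ CondAt n s d
Cond-nonneg n s d₀≡d rewrite d₀≡d = refl

Cond-neg : ∀ n s {k} → d₀ n s ≡ ℤ.-[1+ k ] → ¬ Cond n s
Cond-neg n s d₀≡ rewrite d₀≡ = λ ()

equivalence-false : ∀ {P Q : Set} → ¬ P → ¬ Q → P ⇔ Q
equivalence-false ¬p ¬q = mk⇔ (λ p → contradiction p ¬p) (λ q → contradiction q ¬q)

+-suc-1 : ∀ a → + a + 1ℤ ≡ + suc a
+-suc-1 a = cong +_ (ℕₚ.+-comm a 1)

g≢floorExpr+1 : ∀ n s {g a} → floorExpr n s ≡ + a → g ≢ suc a → + g ≢ floorExpr n s + 1ℤ
g≢floorExpr+1 n s {g} {a} fl g≢ eq = g≢ (ℤₚ.+-injective (trans eq (trans (cong (_+ 1ℤ) fl) (+-suc-1 a))))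

f-peak-at : ∀ n s e G → G ℕ.+ e ≡ n ℕ.+ n → t s e ≤ B n → B n ℕ.< t s (suc e) →
  f n s (suc G) ≤ f n s G → IsArgmax (f n s) G
f-peak-at n s e G G+e≡2n t≤B B<t dec-G =
  argmax (f n s) G (f-increasing-below n s e G G+e≡2n B<t) dec
  where
  dec : ∀ N → G ≤ N → f n s (suc N) ≤ f n s N
  dec N G≤N with ℕₚ.m≤n⇒m<n∨m≡n G≤N
  ... | inj₁ G<N  = f-decreasing-above n s e G G+e≡2n t≤B N G<N
  ... | inj₂ refl = dec-G

f-peak-after : ∀ n s e G → G ℕ.+ e ≡ n ℕ.+ n → t s e ≤ B n → B n ℕ.< t s (suc e) →
  f n s G ≤ f n s (suc G) → IsArgmax (f n s) (suc G)
f-peak-after n s e G G+e≡2n t≤B B<t inc-G =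
  argmax (f n s) (suc G) inc (f-decreasing-above n s e G G+e≡2n t≤B)
  where
  inc : ∀ N → N ℕ.< suc G → f n s N ≤ f n s (suc N)
  inc N (s≤s N≤G) with ℕₚ.m≤n⇒m<n∨m≡n N≤G
  ... | inj₁ N<G  = f-increasing-below n s e G G+e≡2n B<t N N<G
  ... | inj₂ refl = inc-G

Conclusion : ℕ → ℕ → ℕ → Set
Conclusion n s g = IsArgmax (f n s) g × ((+ g ≡ floorExpr n s + 1ℤ) ⇔ Cond n s)

-- Here d₀ = -1, for which the condition is false by convention. The maximum is at G = 2n, beyond
-- which f vanishes, while the floor is G or G + 1 and never G - 1.
conclusion-0 : ∀ n s (digits : RootDigits n s) G → RootDigits.e digits ≡ 0 → G ≡ n ℕ.+ n → Conclusion n s G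
conclusion-0 n s digits G e≡0 G≡2n =
  f-peak-at n s e G G+e≡2n t≤B B<t
    (ℕₚ.≤-trans (ℕₚ.≤-reflexive (N>2n⇒f≡0 n s (s≤s (ℕₚ.≤-reflexive (sym G≡2n))))) z≤n)
  , equivalence-false ≢floor (Cond-neg n s (trans (d₀-value n s digits) (cong (λ e → + e ℤ.- 1ℤ) e≡0)))
  where
  open RootDigits digits
  G+e≡2n : G ℕ.+ e ≡ n ℕ.+ n
  G+e≡2n = trans (cong (G ℕ.+_) e≡0) (trans (ℕₚ.+-identityʳ G) G≡2n)
  ≢floor : + G ≢ floorExpr n s + 1ℤ
  ≢floor with t s e ℕ.≟ B n
  ... | yes t≡B = g≢floorExpr+1 n s (floorExpr-tie n s digits G G+e≡2n t≡B) (ℕₚ.m≢1+n+m G {1})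
  ... | no  t≢B = g≢floorExpr+1 n s (floorExpr-strict n s digits G G+e≡2n t≢B) (ℕₚ.m≢1+n+m G {0})

conclusion-suc : ∀ n s (digits : RootDigits n s) d G → RootDigits.e digits ≡ suc d → G ℕ.+ suc d ≡ n ℕ.+ n →
  ∃ λ g → Conclusion n s g
conclusion-suc n s digits@record { e = _ } d G refl G+e≡2n = by-tie (t s (suc d) ℕ.≟ B n)
  where
  open RootDigits digits
  step = + pℕ n (suc d) ℤ.≤ (+ s ℤ.- + G) ℤ.* + pℕ n d
  cond⇔ : CondAt n s d ⇔ (t s (suc d) ℕ.< B n × step)
  cond⇔ = CondAt⇔ n s d G G+e≡2n
  Cond≡ : Cond n s ≡ CondAt n s d
  Cond≡ = Cond-nonneg n s (d₀-value n s digits)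
  Cond⇒ : Cond n s → t s (suc d) ℕ.< B n × step
  Cond⇒ c = Equivalence.to cond⇔ (subst (λ A → A) Cond≡ c)
  by-tie : _ → ∃ λ g → Conclusion n s g
  -- c_{d₀} = 0 still makes f increase from G to G + 1, but the floor is G + 1 too; and the
  -- condition asks for c_{d₀} > 0.
  by-tie (yes t≡B) = suc G
    , f-peak-after n s (suc d) G G+e≡2n t≤B B<t (f-increasing n s G d G+e≡2n (ℕₚ.≤-reflexive (sym t≡B)))
    , equivalence-false (g≢floorExpr+1 n s (floorExpr-tie n s digits G G+e≡2n t≡B) (ℕₚ.m≢1+n+m (suc G) {0}))
        (λ c → ℕₚ.<-irrefl t≡B (proj₁ (Cond⇒ c)))
  -- Now c_{d₀} > 0 and the floor is G, so `step` alone decides. Equality in it, where f(G) = f(G +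
  -- 1), goes to G + 1, in agreement with the non-strict bound in the condition.
  by-tie (no t≢B) = by-step ((+ pℕ n (suc d)) ℤₚ.≤? ((+ s ℤ.- + G) ℤ.* + pℕ n d))
    where
    floor≡G : floorExpr n s ≡ + G
    floor≡G = floorExpr-strict n s digits G G+e≡2n t≢B
    by-step : _ → ∃ λ g → Conclusion n s g
    by-step (yes up) = suc G
      , f-peak-after n s (suc d) G G+e≡2n t≤B B<t (f-step-≤ n s G d G+e≡2n (≤-monus s G up))
      , mk⇔ (λ _ → subst (λ A → A) (sym Cond≡) (Equivalence.from cond⇔ (ℕₚ.≤∧≢⇒< t≤B t≢B , up)))
            (λ _ → sym (trans (cong (_+ 1ℤ) floor≡G) (+-suc-1 G)))
    by-step (no ¬up) = G
      , f-peak-at n s (suc d) G G+e≡2n t≤B B<t (f-step-≥ n s G d G+e≡2n (monus-≤ s G (ℤₚ.<⇒≤ (ℤₚ.≰⇒> ¬up))))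
      , equivalence-false (g≢floorExpr+1 n s floor≡G (ℕₚ.m≢1+n+m G {0})) (λ c → ¬up (proj₂ (Cond⇒ c)))

theorem1p6 : (s₁ s₂ : ℕ) → 1 ≤ s₁ → 1 ≤ s₂ →
    Σ ℕ (λ g → IsArgmax (f s₁ s₂) g
    × ((+ g ≡ floorExpr s₁ s₂ + 1ℤ) ⇔ Cond s₁ s₂))
theorem1p6 n s _ _ = by-digit (RootDigits.e digits) refl
  where
  digits = rootDigits n s
  -- As e = d₀ + 1, this is 2n - d₀ - 1, where the open step starts.
  G = n ℕ.+ n ∸ RootDigits.e digits
  G+e≡2n : G ℕ.+ RootDigits.e digits ≡ n ℕ.+ n
  G+e≡2n = ℕₚ.m∸n+n≡m (e≤2n n s digits)
  by-digit : ∀ e → RootDigits.e digits ≡ e → ∃ λ g → Conclusion n s g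
  by-digit zero    e≡0 = G , conclusion-0 n s digits G e≡0
    (trans (sym (ℕₚ.+-identityʳ G)) (trans (cong (G ℕ.+_) (sym e≡0)) G+e≡2n))
  by-digit (suc d) e≡d = conclusion-suc n s digits d G e≡d (trans (cong (G ℕ.+_) (sym e≡d)) G+e≡2n)
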